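{- For every positive integer $n$, the polynomial in $q$ $$\binom{2n}{n}_q\;-\;\prod_{i=1}^{n}\bigl(1+q^{2i-1}\bigr)\;=\;\sum_{k=0}^{n^2}\bigl(p_k(n,n)-b_k(n)\bigr)q^k$$ is symmetric and unimodal, i.e. its coefficients $c_k=p_k(n,n)-b_k(n)$ satisfy $c_k=c_{n^2-k}$ and $c_0\le c_1\le\cdots\le c_{\lfloor n^2/2\rfloor}\ge\cdots\ge c_{n^2}$.
   Context: $\binom{2n}{n}_q=\prod_{i=1}^{n}\frac{q^{n+i}-1}{q^i-1}$ is the Gaussian ($q$-binomial) coefficient, and $p_k(n,n)$ is the number of partitions of $k$ fitting inside an $n\times n$ square, so that $\binom{2n}{n}_q=\sum_k p_k(n,n)q^k$. $b_k(n)$ is the number of partitions of $k$ into distinct odd parts each at most $2n-1$, so that $\prod_{i=1}^n(1+q^{2i-1})=\sum_k b_k(n)q^k$. -}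

module Defs where

open import Data.Integer as ℤ using (ℤ; +_; 0ℤ; 1ℤ; -1ℤ)
import Data.Integer.Properties as ℤ
open import Algebra.Properties.AbelianGroup ℤ.+-0-abelianGroup using (∙-cancelˡ)
open import Data.List using (List; []; _∷_; _++_; applyUpTo; filter; length; map; replicate)
open import Data.List.Membership.Propositional using (_∈_)
open import Data.List.Membership.Propositional.Properties using (∈-filter⁺; ∈-filter⁻; ∈-map⁺; ∈-map⁻; ∈-++⁺ˡ; ∈-++⁺ʳ)
open import Data.List.Relation.Unary.All as All using (All; []; _∷_)
import Data.List.Relation.Unary.All.Properties as All
open import Data.List.Relation.Unary.AllPairs using (allPairs?; []; _∷_)
open import Data.List.Relation.Unary.Any using (here)
open import Data.List.Relation.Unary.Linked as Linked using (Linked)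
open import Data.List.Relation.Unary.Unique.Propositional using (Unique)
import Data.List.Relation.Unary.Unique.Propositional.Properties as Unique
open import Data.Nat using (ℕ; zero; suc; _+_; _*_; _∸_; _≤_; _<_; _≥_; z<s; _≟_; _≤?_; _≥?_; ⌊_/2⌋)
open import Data.Nat.Divisibility using (_∣_; _∣?_)
open import Data.Nat.ListAction using (sum)
open import Data.Nat.Properties using (suc-injective)
open import Data.Product using (_×_; _,_)
open import Data.Sum using (inj₁; inj₂)
open import Function using (_⇔_; mk⇔)
open import Relation.Binary.PropositionalEquality using (_≡_; _≢_; refl; sym; trans; cong)
open import Relation.Nullary using (¬_; ¬?; _×-dec_)
open import Relation.Unary using (Decidable)

IsPartition : ℕ → List ℕ → Set
IsPartition k λs = All (0 <_) λs × Linked _≥_ λs × sum λs ≡ k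

incrementHead : List ℕ → List ℕ
incrementHead []       = []
incrementHead (x ∷ xs) = suc x ∷ xs

-- All lists of positive integers with sum k.  One of sum k + 1 either
-- begins with 1 or arises from one of sum k by incrementing its first entry.
compositions : ℕ → List (List ℕ)
compositions zero          = [] ∷ []
compositions (suc zero)    = (1 ∷ []) ∷ []
compositions (suc (suc k)) =
  map (1 ∷_) (compositions (suc k)) ++ map incrementHead (compositions (suc k))

-- Every partition of k exactly once: ∈-partitions and partitions-unique below.
partitions : ℕ → List (List ℕ)
partitions k = filter (Linked.linked? _≥?_) (compositions k)

FitsIn : ℕ → ℕ → List ℕ → Set
FitsIn rows columns λs = length λs ≤ rows × All (_≤ columns) λs

fitsIn? : ∀ rows columns → Decidable (FitsIn rows columns)
fitsIn? rows columns λs = (length λs ≤? rows) ×-dec All.all? (_≤? columns) λs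

DistinctOddUpTo : ℕ → List ℕ → Set
DistinctOddUpTo m λs = Unique λs × All (λ x → ¬ 2 ∣ x) λs × All (_≤ m) λs

distinctOddUpTo? : ∀ m → Decidable (DistinctOddUpTo m)
distinctOddUpTo? m λs =
  allPairs? (λ x y → ¬? (x ≟ y)) λs
    ×-dec All.all? (λ x → ¬? (2 ∣? x)) λs
    ×-dec All.all? (_≤? m) λs

p : ℕ → ℕ → ℕ → ℕ
p k a b = length (filter (fitsIn? a b) (partitions k))

b : ℕ → ℕ → ℕ
b k n = length (filter (distinctOddUpTo? (2 * n ∸ 1)) (partitions k))

c : ℕ → ℕ → ℤ
c n k = + p k n n ℤ.- + b k n

-- Polynomials in q over ℤ, as coefficient lists with the constant term
-- first.  Trailing zeros are allowed, so equality is _≈_.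

Poly : Set
Poly = List ℤ

coeff : Poly → ℕ → ℤ
coeff []      _       = 0ℤ
coeff (x ∷ f) zero    = x
coeff (x ∷ f) (suc k) = coeff f k

infix 4 _≈_
_≈_ : Poly → Poly → Set
f ≈ g = ∀ k → coeff f k ≡ coeff g k

infixl 6 _⊕_ _⊖_
infixl 7 _⊛_

_⊕_ : Poly → Poly → Poly
[]      ⊕ g       = g
(x ∷ f) ⊕ []      = x ∷ f
(x ∷ f) ⊕ (y ∷ g) = (x ℤ.+ y) ∷ (f ⊕ g)

scale : ℤ → Poly → Poly
scale x = map (x ℤ.*_)

_⊖_ : Poly → Poly → Poly
f ⊖ g = f ⊕ scale -1ℤ g

_⊛_ : Poly → Poly → Poly
[]      ⊛ g = []
(x ∷ f) ⊛ g = scale x g ⊕ (0ℤ ∷ f ⊛ g)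

𝟙 : Poly
𝟙 = 1ℤ ∷ []

q^_ : ℕ → Poly
q^ k = replicate k 0ℤ ++ 𝟙

-- ∏ n f = f 1 ⊛ ⋯ ⊛ f n
∏ : ℕ → (ℕ → Poly) → Poly
∏ zero    f = 𝟙
∏ (suc n) f = ∏ n f ⊛ f (suc n)

-- ∑q a N = a 0 + a 1 q + ⋯ + a N q^N
∑q : (ℕ → ℤ) → ℕ → Poly
∑q a N = applyUpTo a (suc N)

-- G is the polynomial ∏_{i=1}^n (q^{n+i} - 1)/(q^i - 1), with denominators
-- cleared; it is unique by gaussian-unique below.
IsCentralGaussian : ℕ → Poly → Set
IsCentralGaussian n G =
  G ⊛ ∏ n (λ i → q^ i ⊖ 𝟙) ≈ ∏ n (λ i → q^ (n + i) ⊖ 𝟙)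

oddProduct : ℕ → Poly
oddProduct n = ∏ n (λ i → 𝟙 ⊕ q^ (2 * i ∸ 1))

Symmetric : ℕ → (ℕ → ℤ) → Set
Symmetric N a = ∀ k → k ≤ N → a k ≡ a (N ∸ k)

UnimodalAtMiddle : ℕ → (ℕ → ℤ) → Set
UnimodalAtMiddle N a =
    (∀ k → k < ⌊ N /2⌋ → a k ℤ.≤ a (suc k))
  × (∀ k → ⌊ N /2⌋ ≤ k → k < N → a k ℤ.≥ a (suc k))

incrementHead-sound : ∀ {k} xs → All (0 <_) xs × sum xs ≡ suc k →
  All (0 <_) (incrementHead xs) × sum (incrementHead xs) ≡ suc (suc k)
incrementHead-sound (x ∷ xs) (_ ∷ pos , eq) = z<s ∷ pos , cong suc eq

compositions-all : ∀ k → All (λ xs → All (0 <_) xs × sum xs ≡ k) (compositions k)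
compositions-all zero          = ([] , refl) ∷ []
compositions-all (suc zero)    = (z<s ∷ [] , refl) ∷ []
compositions-all (suc (suc k)) = All.++⁺
  (All.map⁺ (All.map (λ (pos , eq) → z<s ∷ pos , cong suc eq) (compositions-all (suc k))))
  (All.map⁺ (All.map (incrementHead-sound _) (compositions-all (suc k))))

compositions-sound : ∀ k {xs} → xs ∈ compositions k → All (0 <_) xs × sum xs ≡ k
compositions-sound k = All.lookup (compositions-all k)

compositions-complete : ∀ k {xs} → All (0 <_) xs → sum xs ≡ k → xs ∈ compositions k
compositions-complete zero [] refl = here refl
compositions-complete zero {suc x ∷ xs} (_ ∷ _) ()
compositions-complete (suc zero) {suc zero ∷ []} _ _ = here refl
compositions-complete (suc zero) {suc zero ∷ zero ∷ xs} (_ ∷ () ∷ _) _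
compositions-complete (suc (suc k)) {suc zero ∷ xs} (_ ∷ pos) eq =
  ∈-++⁺ˡ (∈-map⁺ (1 ∷_) (compositions-complete (suc k) pos (suc-injective eq)))
compositions-complete (suc (suc k)) {suc (suc x) ∷ xs} (_ ∷ pos) eq =
  ∈-++⁺ʳ (map (1 ∷_) (compositions (suc k)))
    (∈-map⁺ incrementHead (compositions-complete (suc k) (z<s ∷ pos) (suc-injective eq)))

incrementHead-injective : ∀ {xs ys} → incrementHead xs ≡ incrementHead ys → xs ≡ ys
incrementHead-injective {[]}    {[]}    _    = refl
incrementHead-injective {_ ∷ _} {_ ∷ _} refl = refl

compositions-unique : ∀ k → Unique (compositions k)
compositions-unique zero          = [] ∷ []
compositions-unique (suc zero)    = [] ∷ []
compositions-unique (suc (suc k)) =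
  Unique.++⁺ (Unique.map⁺ (λ { refl → refl }) (compositions-unique (suc k)))
             (Unique.map⁺ incrementHead-injective (compositions-unique (suc k)))
             disjoint
  where
  disjoint : ∀ {v} → ¬ (v ∈ map (1 ∷_) (compositions (suc k))
                      × v ∈ map incrementHead (compositions (suc k)))
  disjoint (i , j) with ∈-map⁻ (1 ∷_) i
  ... | _ , _ , refl with ∈-map⁻ incrementHead j
  ...   | zero ∷ _ , ys∈ , refl with () ∷ _ , _ ← compositions-sound (suc k) ys∈

∈-partitions : ∀ k {λs} → λs ∈ partitions k ⇔ IsPartition k λs
∈-partitions k = mk⇔
  (λ i → let j , linked = ∈-filter⁻ (Linked.linked? _≥?_) i
             pos , eq = compositions-sound k j
         in pos , linked , eq)
  (λ (pos , linked , eq) →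
    ∈-filter⁺ (Linked.linked? _≥?_) (compositions-complete k pos eq) linked)

partitions-unique : ∀ k → Unique (partitions k)
partitions-unique k = Unique.filter⁺ (Linked.linked? _≥?_) (compositions-unique k)

coeff-⊕ : ∀ f g k → coeff (f ⊕ g) k ≡ coeff f k ℤ.+ coeff g k
coeff-⊕ []      g       k       = sym (ℤ.+-identityˡ _)
coeff-⊕ (x ∷ f) []      k       = sym (ℤ.+-identityʳ _)
coeff-⊕ (x ∷ f) (y ∷ g) zero    = refl
coeff-⊕ (x ∷ f) (y ∷ g) (suc k) = coeff-⊕ f g k

coeff-scale : ∀ x f k → coeff (scale x f) k ≡ x ℤ.* coeff f k
coeff-scale x []      k       = sym (ℤ.*-zeroʳ x)
coeff-scale x (y ∷ f) zero    = refl
coeff-scale x (y ∷ f) (suc k) = coeff-scale x f k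

coeff-⊛-zero : ∀ f g → coeff (f ⊛ g) 0 ≡ coeff f 0 ℤ.* coeff g 0
coeff-⊛-zero []      g = sym (ℤ.*-zeroˡ (coeff g 0))
coeff-⊛-zero (x ∷ f) g =
  trans (coeff-⊕ (scale x g) _ 0) (trans (ℤ.+-identityʳ _) (coeff-scale x g 0))

coeff-⊛-suc : ∀ x f g k →
  coeff ((x ∷ f) ⊛ g) (suc k) ≡ x ℤ.* coeff g (suc k) ℤ.+ coeff (f ⊛ g) k
coeff-⊛-suc x f g k =
  trans (coeff-⊕ (scale x g) _ (suc k)) (cong (ℤ._+ _) (coeff-scale x g (suc k)))

⊛-cancelʳ : ∀ f f′ g → coeff g 0 ≢ 0ℤ → f ⊛ g ≈ f′ ⊛ g → f ≈ f′
⊛-cancelʳ f f′ g g₀≢0 eq = go f f′ eq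
  where
  instance _ = ℤ.≢-nonZero g₀≢0

  heads : ∀ f f′ → f ⊛ g ≈ f′ ⊛ g → coeff f 0 ≡ coeff f′ 0
  heads f f′ eq = ℤ.*-cancelʳ-≡ _ _ (coeff g 0)
    (trans (sym (coeff-⊛-zero f g)) (trans (eq 0) (coeff-⊛-zero f′ g)))

  []-step : ∀ y f → [] ≈ (y ∷ f) ⊛ g → [] ≈ f ⊛ g
  []-step y f eq k with refl ← heads [] (y ∷ f) eq =
    trans (eq (suc k)) (trans (coeff-⊛-suc 0ℤ f g k) (ℤ.+-identityˡ _))

  go : ∀ f f′ → f ⊛ g ≈ f′ ⊛ g → f ≈ f′
  go []      []       eq k       = refl
  go []      (y ∷ f′) eq zero    = heads [] (y ∷ f′) eq
  go []      (y ∷ f′) eq (suc k) = go [] f′ ([]-step y f′ eq) k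
  go (x ∷ f) []       eq zero    = heads (x ∷ f) [] eq
  go (x ∷ f) []       eq (suc k) =
    go f [] (λ j → sym ([]-step x f (λ i → sym (eq i)) j)) k
  go (x ∷ f) (y ∷ f′) eq zero    = heads (x ∷ f) (y ∷ f′) eq
  go (x ∷ f) (y ∷ f′) eq (suc k) with refl ← heads (x ∷ f) (y ∷ f′) eq =
    go f f′ (λ j → ∙-cancelˡ (x ℤ.* coeff g (suc j)) _ _
      (trans (sym (coeff-⊛-suc x f g j)) (trans (eq (suc j)) (coeff-⊛-suc x f′ g j)))) k

denominator₀≢0 : ∀ n → coeff (∏ n (λ i → q^ i ⊖ 𝟙)) 0 ≢ 0ℤ
denominator₀≢0 zero    ()
denominator₀≢0 (suc n) eq
  with ℤ.i*j≡0⇒i≡0∨j≡0 (coeff (∏ n (λ i → q^ i ⊖ 𝟙)) 0)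
         (trans (sym (coeff-⊛-zero (∏ n (λ i → q^ i ⊖ 𝟙)) (q^ suc n ⊖ 𝟙))) eq)
... | inj₁ eq′ = denominator₀≢0 n eq′
... | inj₂ ()

gaussian-unique : ∀ n {G G′} → IsCentralGaussian n G → IsCentralGaussian n G′ → G ≈ G′
gaussian-unique n {G} {G′} isG isG′ =
  ⊛-cancelʳ G G′ _ (denominator₀≢0 n) (λ k → trans (isG k) (sym (isG′ k)))

{-# OPTIONS --safe #-}

-- Encode a partition inside the n × n square as a word with n zeros and n
-- ones, whose size is the number of pairs "zero before one".  Reversing and
-- complementing words is conjugation of partitions, and b_k(n) counts the
-- self-conjugate partitions of k, so p_k(n,n) - b_k(n) is twice the dimension
-- of the space of functions on rank k that are antisymmetric under conjugation.
--
-- Functions on these words form the representation Λⁿ(V) of sl₂ with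
-- dim V = 2n.  Its raising operator E (add a box) commutes with conjugation,
-- and E F - F E = 2k - n² on rank k makes E injective below the middle rank.
-- So the dimensions of the antisymmetric parts increase up to the middle;
-- complementation in the square gives the symmetry.
module Submission where

open import Defs
open import Algebra.Bundles using (CommutativeRing)
open import Data.Bool using (Bool; true; false; not)
import Data.Bool as Bool
import Data.Bool.Properties as Bool
open import Data.Empty using (⊥-elim)
open import Data.Integer as ℤ using (ℤ; +_; 0ℤ; 1ℤ; -1ℤ; -_)
import Data.Integer.Properties as ℤ
open import Data.Integer.Solver using (module +-*-Solver)
open import Data.Integer.Tactic.RingSolver using (solve-∀)
open import Data.List using (List; []; _∷_; _∷ʳ_; _++_; length; map; filter; foldr; replicate; initLast; _∷ʳ′_)
import Data.List.Properties as List
open import Data.List.Membership.Propositional using (_∈_; find)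
open import Data.List.Membership.Propositional.Properties using (∈-filter⁺; ∈-filter⁻; ∈-map⁺; ∈-map⁻; ∈-++⁺ˡ; ∈-++⁺ʳ; ∈-∃++)
open import Data.List.Membership.Propositional.Properties.WithK using (unique∧set⇒bag)
open import Data.List.Relation.Binary.BagAndSetEquality using (∼bag⇒↭)
open import Data.List.Relation.Binary.Lex using (halt; this; next; base)
import Data.List.Relation.Binary.Lex.Strict as Lex
open import Data.List.Relation.Binary.Permutation.Propositional.Properties using (↭-length)
open import Data.List.Relation.Binary.Pointwise using (Pointwise-≡⇒≡; ≡⇒Pointwise-≡)
open import Data.List.Relation.Unary.All as All using (All; []; _∷_)
import Data.List.Relation.Unary.All.Properties as All
open import Data.List.Relation.Unary.AllPairs using (AllPairs; []; _∷_)
open import Data.List.Relation.Unary.Any using (Any; here; there)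
open import Data.List.Relation.Unary.Linked as Linked using (Linked; []; [-]; _∷_)
import Data.List.Relation.Unary.Linked.Properties as Linked
open import Data.List.Relation.Unary.Unique.Propositional using (Unique)
import Data.List.Relation.Unary.Unique.Propositional.Properties as Unique
open import Data.Maybe as Maybe using (Maybe; just; nothing)
open import Data.Nat as ℕ using (ℕ; zero; suc; _+_; _*_; _∸_; _<_; _≤_; _≥_; z≤n; s≤s; z<s; ⌊_/2⌋; NonZero)
open import Data.Nat.Divisibility using (_∣_; ∣m+n∣m⇒∣n; m∣m*n; ∣⇒≤)
open import Data.Nat.ListAction using (sum)
import Data.Nat.Properties as ℕ
open import Data.Nat.Tactic.RingSolver using () renaming (solve-∀ to ℕ-solve-∀)
open import Data.Product using (∃-syntax; _×_; _,_; proj₁; proj₂)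
open import Data.Sum using (inj₁; inj₂)
open import Function using (_∘_; mk⇔; module Equivalence)
open import Level using (0ℓ)
open import Relation.Binary using (tri<; tri≈; tri>; Trichotomous)
open import Relation.Binary.Bundles using (Setoid)
open import Relation.Binary.PropositionalEquality using (_≡_; _≢_; refl; sym; trans; cong; cong₂; subst; module ≡-Reasoning)
open import Relation.Nullary using (¬_; Dec; yes; no)
open import Relation.Unary using (Decidable)
import Tactic.RingSolver as Solver
import Tactic.RingSolver.Core.AlmostCommutativeRing as ACR

-- The sl₂ action on functions of words

-- Everything stays over the integers, so neither injectivity nor linear algebra may divide. `E`
-- therefore has all coefficients 1, and the coefficients that sl₂ requires sit in `F`: they are
-- those of the irreducible representation in a basis on which raising is a shift. Injectivity uses
-- no eigenspace decomposition and no inner product. If E g = 0 below the middle, then E F g is a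
-- negative multiple of g. Each further `F` makes the scalar more negative, until rank 0, where `F`
-- has nothing left to read; the scalars are nonzero, so all these functions vanish in turn, g last.
-- An inequality between two counts is extracted by contradiction: a drop in the count would, by
-- elimination, produce a nonzero antisymmetric function killed by `E`. On the enumerative side the
-- square alone admits no recursion, so words, partitions and Gaussian products are compared over
-- all rectangles, by Pascal's rule.

Word : Set
Word = List Bool

ones zeros : Word → ℕ
ones []          = 0
ones (true  ∷ w) = suc (ones w)
ones (false ∷ w) = ones w
zeros []          = 0
zeros (true  ∷ w) = zeros w
zeros (false ∷ w) = suc (zeros w)

rank : Word → ℕ
rank []          = 0
rank (true  ∷ w) = rank w
rank (false ∷ w) = ones w ℕ.+ rank w

infix 4 _⋖_
-- Adding one box: an adjacent pair 10 becomes 01, which creates exactly one new pair "zero before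
-- one".
data _⋖_ : Word → Word → Set where
  swap : ∀ w → true ∷ false ∷ w ⋖ false ∷ true ∷ w
  skip : ∀ a {v w} → v ⋖ w → a ∷ v ⋖ a ∷ w

⋖-ones : ∀ {v w} → v ⋖ w → ones v ≡ ones w
⋖-ones (swap w)       = refl
⋖-ones (skip true s)  = cong suc (⋖-ones s)
⋖-ones (skip false s) = ⋖-ones s

⋖-zeros : ∀ {v w} → v ⋖ w → zeros v ≡ zeros w
⋖-zeros (swap w)       = refl
⋖-zeros (skip true s)  = ⋖-zeros s
⋖-zeros (skip false s) = cong suc (⋖-zeros s)

⋖-length : ∀ {v w} → v ⋖ w → length v ≡ length w
⋖-length (swap w)   = refl
⋖-length (skip a s) = cong suc (⋖-length s)

⋖-rank : ∀ {v w} → v ⋖ w → suc (rank v) ≡ rank w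
⋖-rank (swap w)       = refl
⋖-rank (skip true s)  = ⋖-rank s
⋖-rank (skip false {v} {w} s) rewrite ⋖-ones s =
  trans (sym (ℕ.+-suc (ones w) (rank v))) (cong (ones w ℕ.+_) (⋖-rank s))

Fun : Set
Fun = Word → ℤ

E₁ : Fun → Fun
E₁ f (false ∷ true ∷ w) = f (true ∷ false ∷ w)
E₁ f _                  = 0ℤ

-- On functions the action is transposed: the value at `w` collects the values at the words one box
-- smaller, so the support moves up by one rank.
E : Fun → Fun
E f []      = 0ℤ
E f (a ∷ w) = E₁ f (a ∷ w) ℤ.+ E (f ∘ (a ∷_)) w

E-cong : ∀ {f g} w → (∀ {v} → v ⋖ w → f v ≡ g v) → E f w ≡ E g w
E-cong []      f≡g = refl
E-cong {f} {g} (a ∷ w) f≡g = cong₂ ℤ._+_ (head (a ∷ w) f≡g) (E-cong w (f≡g ∘ skip a))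
  where
  head : ∀ w → (∀ {v} → v ⋖ w → f v ≡ g v) → E₁ f w ≡ E₁ g w
  head []                 _  = refl
  head (true ∷ _)         _  = refl
  head (false ∷ [])       _  = refl
  head (false ∷ false ∷ w) _ = refl
  head (false ∷ true ∷ w) eq = eq (swap w)

E-+ : ∀ f g w → E (λ v → f v ℤ.+ g v) w ≡ E f w ℤ.+ E g w
E-+ f g []      = refl
E-+ f g (a ∷ w) = trans (cong₂ ℤ._+_ (head (a ∷ w)) (E-+ (f ∘ (a ∷_)) (g ∘ (a ∷_)) w))
                        (interchange (E₁ f (a ∷ w)) _ _ _)
  where
  interchange : ∀ p q r s → (p ℤ.+ q) ℤ.+ (r ℤ.+ s) ≡ (p ℤ.+ r) ℤ.+ (q ℤ.+ s)
  interchange = solve-∀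
  head : ∀ w → E₁ (λ v → f v ℤ.+ g v) w ≡ E₁ f w ℤ.+ E₁ g w
  head []                  = refl
  head (true ∷ _)          = refl
  head (false ∷ [])        = refl
  head (false ∷ false ∷ w) = refl
  head (false ∷ true ∷ w)  = refl

E-* : ∀ m f w → E (λ v → m ℤ.* f v) w ≡ m ℤ.* E f w
E-* m f []      = sym (ℤ.*-zeroʳ m)
E-* m f (a ∷ w) = trans (cong₂ ℤ._+_ (head (a ∷ w)) (E-* m (f ∘ (a ∷_)) w))
                        (sym (ℤ.*-distribˡ-+ m (E₁ f (a ∷ w)) _))
  where
  head : ∀ w → E₁ (λ v → m ℤ.* f v) w ≡ m ℤ.* E₁ f w
  head []                  = sym (ℤ.*-zeroʳ m)
  head (true ∷ _)          = sym (ℤ.*-zeroʳ m)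
  head (false ∷ [])        = sym (ℤ.*-zeroʳ m)
  head (false ∷ false ∷ w) = sym (ℤ.*-zeroʳ m)
  head (false ∷ true ∷ w)  = refl

E-zero : ∀ {f} w → (∀ {v} → v ⋖ w → f v ≡ 0ℤ) → E f w ≡ 0ℤ
E-zero w f≡0 = trans (E-cong w f≡0) (trans (E-* 0ℤ (λ _ → 0ℤ) w) (ℤ.*-zeroˡ (E (λ _ → 0ℤ) w)))

-- The weight of a move depends only on the number of letters behind it, which prefixing a letter
-- leaves alone; hence the recursion through `f ∘ (a ∷_)`. The commutator with `E` is diagonal for
-- every `u`; a special `u` makes the diagonal depend on the rank alone.
module Lowering (u : ℕ → ℤ) where

  F₁ : Fun → Fun
  F₁ f (true ∷ false ∷ w) = u (length w) ℤ.* f (false ∷ true ∷ w)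
  F₁ f _                  = 0ℤ

  F : Fun → Fun
  F f []      = 0ℤ
  F f (a ∷ w) = F₁ f (a ∷ w) ℤ.+ F (f ∘ (a ∷_)) w

  F-cong : ∀ {f g} w → (∀ {v} → w ⋖ v → f v ≡ g v) → F f w ≡ F g w
  F-cong []      f≡g = refl
  F-cong {f} {g} (a ∷ w) f≡g = cong₂ ℤ._+_ (head (a ∷ w) f≡g) (F-cong w (f≡g ∘ skip a))
    where
    head : ∀ w → (∀ {v} → w ⋖ v → f v ≡ g v) → F₁ f w ≡ F₁ g w
    head []                  _ = refl
    head (false ∷ _)         _ = refl
    head (true ∷ [])         _ = refl
    head (true ∷ true ∷ w)   _ = refl
    head (true ∷ false ∷ w) eq = cong (u (length w) ℤ.*_) (eq (swap w))

  F-* : ∀ m f w → F (λ v → m ℤ.* f v) w ≡ m ℤ.* F f w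
  F-* m f []      = sym (ℤ.*-zeroʳ m)
  F-* m f (a ∷ w) = trans (cong₂ ℤ._+_ (head (a ∷ w)) (F-* m (f ∘ (a ∷_)) w))
                          (sym (ℤ.*-distribˡ-+ m (F₁ f (a ∷ w)) _))
    where
    exchange : ∀ p q r → p ℤ.* (q ℤ.* r) ≡ q ℤ.* (p ℤ.* r)
    exchange = solve-∀
    head : ∀ w → F₁ (λ v → m ℤ.* f v) w ≡ m ℤ.* F₁ f w
    head []                  = sym (ℤ.*-zeroʳ m)
    head (false ∷ _)         = sym (ℤ.*-zeroʳ m)
    head (true ∷ [])         = sym (ℤ.*-zeroʳ m)
    head (true ∷ true ∷ w)   = sym (ℤ.*-zeroʳ m)
    head (true ∷ false ∷ w)  = exchange (u (length w)) m _

  F-+ : ∀ f g w → F (λ v → f v ℤ.+ g v) w ≡ F f w ℤ.+ F g w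
  F-+ f g []      = refl
  F-+ f g (a ∷ w) = trans (cong₂ ℤ._+_ (head (a ∷ w)) (F-+ (f ∘ (a ∷_)) (g ∘ (a ∷_)) w))
                          (interchange (F₁ f (a ∷ w)) _ _ _)
    where
    interchange : ∀ p q r s → (p ℤ.+ q) ℤ.+ (r ℤ.+ s) ≡ (p ℤ.+ r) ℤ.+ (q ℤ.+ s)
    interchange = solve-∀
    head : ∀ w → F₁ (λ v → f v ℤ.+ g v) w ≡ F₁ f w ℤ.+ F₁ g w
    head []                  = refl
    head (false ∷ _)         = refl
    head (true ∷ [])         = refl
    head (true ∷ true ∷ w)   = refl
    head (true ∷ false ∷ w)  = ℤ.*-distribˡ-+ (u (length w)) _ _

  F-zero : ∀ {f} w → (∀ {v} → w ⋖ v → f v ≡ 0ℤ) → F f w ≡ 0ℤ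
  F-zero w f≡0 = trans (F-cong w f≡0) (trans (F-* 0ℤ (λ _ → 0ℤ) w) (ℤ.*-zeroˡ (F (λ _ → 0ℤ) w)))

  -- At a pair 01 the front move can be undone and redone, a term of `E F`; at a pair 10 it can be
  -- done and undone, a term of `F E`.
  δ₁ : Word → ℤ
  δ₁ (false ∷ true ∷ w) = u (length w)
  δ₁ (true ∷ false ∷ w) = - u (length w)
  δ₁ _                  = 0ℤ

  δ : Word → ℤ
  δ []      = 0ℤ
  δ (a ∷ w) = δ₁ (a ∷ w) ℤ.+ δ w

  private
    F₁E₁≡0 : ∀ f w → F₁ (λ v → E₁ f (false ∷ v)) (true ∷ w) ≡ 0ℤ
    F₁E₁≡0 f []          = refl
    F₁E₁≡0 f (true ∷ w)  = refl
    F₁E₁≡0 f (false ∷ w) = ℤ.*-zeroʳ (u (length w))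

    E₁F₁≡0 : ∀ f w → E₁ (λ v → F₁ f (true ∷ v)) (false ∷ w) ≡ 0ℤ
    E₁F₁≡0 f []          = refl
    E₁F₁≡0 f (true ∷ w)  = refl
    E₁F₁≡0 f (false ∷ w) = refl

  -- The composites of a move at the front with a move further back.
  -- Overlapping moves never compose, disjoint ones commute, and a move
  -- followed by its reverse contributes to the diagonal.
  front : ∀ f a w →
    E₁ (F f) (a ∷ w) ℤ.+ E (λ v → F₁ f (a ∷ v)) w ≡
    F₁ (E f) (a ∷ w) ℤ.+ F (λ v → E₁ f (a ∷ v)) w ℤ.+ δ₁ (a ∷ w) ℤ.* f (a ∷ w)
  front f false []          = refl
  front f true  []          = refl
  front f false (false ∷ w)
    rewrite E-zero {λ v → F₁ f (false ∷ v)} (false ∷ w) (λ _ → refl)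
          | F-zero {λ v → E₁ f (false ∷ false ∷ v)} w (λ _ → refl) = refl
  front f true  (true ∷ w)
    rewrite E-zero {λ v → F₁ f (true ∷ true ∷ v)} w (λ _ → refl)
          | F-zero {λ v → E₁ f (true ∷ v)} (true ∷ w) (λ _ → refl) = refl
  front f false (true ∷ w)
    rewrite E-zero {λ v → F₁ f (false ∷ v)} (true ∷ w) (λ _ → refl)
          | F₁E₁≡0 f w = shuffle (u (length w) ℤ.* f (false ∷ true ∷ w)) (F (λ v → f (true ∷ false ∷ v)) w)
    where
    shuffle : ∀ p q → p ℤ.+ (0ℤ ℤ.+ q) ℤ.+ 0ℤ ≡ 0ℤ ℤ.+ (0ℤ ℤ.+ q) ℤ.+ p
    shuffle = solve-∀
  front f true  (false ∷ w)
    rewrite F-zero {λ v → E₁ f (true ∷ v)} (false ∷ w) (λ _ → refl)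
          | E₁F₁≡0 f w
          -- A move further back preserves the length of the rest, so the weight of the front move
          -- is a constant that leaves `E`.
          | E-cong {λ v → F₁ f (true ∷ false ∷ v)} {λ v → u (length w) ℤ.* f (false ∷ true ∷ v)} w
              (λ {v} s → cong (λ ℓ → u ℓ ℤ.* f (false ∷ true ∷ v)) (⋖-length s))
          | E-* (u (length w)) (λ v → f (false ∷ true ∷ v)) w = shuffle (u (length w)) _ _
    where
    shuffle : ∀ p q r → 0ℤ ℤ.+ (0ℤ ℤ.+ p ℤ.* q) ≡ p ℤ.* (r ℤ.+ (0ℤ ℤ.+ q)) ℤ.+ 0ℤ ℤ.+ (- p) ℤ.* r
    shuffle = solve-∀

  commutator : ∀ f w → E (F f) w ≡ F (E f) w ℤ.+ δ w ℤ.* f w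
  commutator f []      = refl
  commutator f (a ∷ w)
    rewrite E-+ (λ v → F₁ f (a ∷ v)) (F (f ∘ (a ∷_))) w
          | F-+ (λ v → E₁ f (a ∷ v)) (E (f ∘ (a ∷_))) w
          | commutator (f ∘ (a ∷_)) w
    = trans (sym (ℤ.+-assoc (E₁ (F f) (a ∷ w)) _ _))
     (trans (cong (ℤ._+ (F (E (f ∘ (a ∷_))) w ℤ.+ δ w ℤ.* f (a ∷ w))) (front f a w))
            (shuffle (F₁ (E f) (a ∷ w)) (F (λ v → E₁ f (a ∷ v)) w) (δ₁ (a ∷ w)) (δ w) (f (a ∷ w))
                     (F (E (f ∘ (a ∷_))) w)))
    where
    shuffle : ∀ p q r s x t → (p ℤ.+ q ℤ.+ r ℤ.* x) ℤ.+ (t ℤ.+ s ℤ.* x) ≡ p ℤ.+ (q ℤ.+ t) ℤ.+ (r ℤ.+ s) ℤ.* x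
    shuffle = solve-∀

length≡ones+zeros : ∀ w → length w ≡ ones w ℕ.+ zeros w
length≡ones+zeros []          = refl
length≡ones+zeros (true ∷ w)  = cong suc (length≡ones+zeros w)
length≡ones+zeros (false ∷ w) = trans (cong suc (length≡ones+zeros w)) (sym (ℕ.+-suc (ones w) (zeros w)))

-- The weight (i + 1)(m - 1 - i) of a move at positions i, i + 1 of a word of
-- length m, in terms of the number ℓ = m - 2 - i of letters that follow.
weight : ℤ → ℕ → ℤ
weight m ℓ = (m ℤ.- 1ℤ ℤ.- + ℓ) ℤ.* (1ℤ ℤ.+ + ℓ)

lead : Word → ℤ
lead (true ∷ _) = 1ℤ
lead _          = 0ℤ

-- Summation by parts: a one at position i contributes the difference i(m - i) - (i + 1)(m - 1 - i)
-- = 2i + 1 - m of the weights on its two sides, its sl₂ weight. The positions of the ones, counted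
-- from the start s = m - (o + z) of the suffix, add up to r + o(o - 1)/2. A one at the very front
-- has no pair on its left inside the suffix, so s(m - s) is taken back when l = 1.
diagonal : ℤ → ℤ → ℤ → ℤ → ℤ → ℤ
diagonal m r o z l =
  + 2 ℤ.* r ℤ.+ o ℤ.* (m ℤ.- (o ℤ.+ z) ℤ.- z) ℤ.- l ℤ.* ((m ℤ.- (o ℤ.+ z)) ℤ.* (o ℤ.+ z))

open +-*-Solver using (Polynomial; solve; con; _:+_; _:*_; _:-_; :-_; _:=_)

private
  :diagonal : ∀ {n} (m r o z l : Polynomial n) → Polynomial n
  :diagonal m r o z l =
    con (+ 2) :* r :+ o :* (m :- (o :+ z) :- z) :- l :* ((m :- (o :+ z)) :* (o :+ z))

  :weight : ∀ {n} (m ℓ : Polynomial n) → Polynomial n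
  :weight m ℓ = (m :- con 1ℤ :- ℓ) :* (con 1ℤ :+ ℓ)

  :0 :1 : ∀ {n} → Polynomial n
  :0 = con 0ℤ
  :1 = con 1ℤ

module _ (m : ℤ) where
  open Lowering (weight m)

  -- For a suffix w of a word of length m; the last term of the diagonal
  -- vanishes when w is the whole word, since then o + z = m.
  δ-formula : ∀ w → δ w ≡ diagonal m (+ rank w) (+ ones w) (+ zeros w) (lead w)
  δ-formula []           = refl
  δ-formula (false ∷ []) = refl
  δ-formula (true ∷ [])  = solve 1 (λ m → :0 := :diagonal m :0 :1 :0 :1) refl m
  δ-formula (false ∷ false ∷ w) rewrite δ-formula (false ∷ w) =
    solve 4 (λ m r o z → :0 :+ :diagonal m (o :+ r) o (:1 :+ z) :0
                       := :diagonal m (o :+ (o :+ r)) o (:1 :+ (:1 :+ z)) :0)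
      refl m (+ rank w) (+ ones w) (+ zeros w)
  δ-formula (true ∷ true ∷ w) rewrite δ-formula (true ∷ w) =
    solve 4 (λ m r o z → :0 :+ :diagonal m r (:1 :+ o) z :1
                       := :diagonal m r (:1 :+ (:1 :+ o)) z :1)
      refl m (+ rank w) (+ ones w) (+ zeros w)
  δ-formula (false ∷ true ∷ w) rewrite δ-formula (true ∷ w) | length≡ones+zeros w =
    solve 4 (λ m r o z → :weight m (o :+ z) :+ :diagonal m r (:1 :+ o) z :1
                       := :diagonal m (:1 :+ o :+ r) (:1 :+ o) (:1 :+ z) :0)
      refl m (+ rank w) (+ ones w) (+ zeros w)
  δ-formula (true ∷ false ∷ w) rewrite δ-formula (false ∷ w) | length≡ones+zeros w =
    solve 4 (λ m r o z → :- :weight m (o :+ z) :+ :diagonal m (o :+ r) o (:1 :+ z) :0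
                       := :diagonal m (o :+ r) (:1 :+ o) (:1 :+ z) :1)
      refl m (+ rank w) (+ ones w) (+ zeros w)

diagonal-full : ∀ n r l → diagonal (n ℤ.+ n) r n n l ≡ + 2 ℤ.* r ℤ.- n ℤ.* n
diagonal-full = solve 3 (λ n r l → :diagonal (n :+ n) r n n l := con (+ 2) :* r :- n :* n) refl

Box : ℕ → Word → Set
Box n w = zeros w ≡ n × ones w ≡ n

box-⋖ : ∀ {n v w} → v ⋖ w → Box n w → Box n v
box-⋖ s (z , o) = trans (⋖-zeros s) z , trans (⋖-ones s) o

box-⋗ : ∀ {n v w} → v ⋖ w → Box n v → Box n w
box-⋗ s (z , o) = trans (sym (⋖-zeros s)) z , trans (sym (⋖-ones s)) o

-- Functions are defined on all words, but only their values on `Box n` are ever constrained; moves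
-- preserve `Box n` in both directions, so `E` and `F` read nothing outside it.
Supported : ℕ → ℕ → Fun → Set
Supported n k f = ∀ w → Box n w → rank w ≢ k → f w ≡ 0ℤ

module _ (n : ℕ) where
  open Lowering (weight (+ n ℤ.+ + n))

  δ-box : ∀ w → Box n w → δ w ≡ + 2 ℤ.* + rank w ℤ.- + n ℤ.* + n
  δ-box w (z≡n , o≡n) rewrite δ-formula (+ n ℤ.+ + n) w | z≡n | o≡n =
    diagonal-full (+ n) (+ rank w) (lead w)

  -- E (F g) = F (E g) + (2k - n²) g = -(m + n² - 2k) g, so F g satisfies the
  -- hypothesis one rank lower.  It vanishes by induction, hence so does E (F g).
  FE-negative⇒zero : ∀ k m g → Supported n k g → k ℕ.+ k < n ℕ.* n →
    (∀ w → Box n w → F (E g) w ≡ - (+ m) ℤ.* g w) → ∀ w → Box n w → g w ≡ 0ℤ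
  FE-negative⇒zero k m g supp 2k<N FEg w box = cancel
    where
    d : ℕ
    -- Minus the sl₂ weight of rank k, positive below the middle; truncation is harmless by `2k<N`.
    d = n ℕ.* n ℕ.∸ (k ℕ.+ k)

    m+d : ℕ
    m+d = m ℕ.+ d

    arith : ∀ m k N x → - m ℤ.* x ℤ.+ (+ 2 ℤ.* k ℤ.- N) ℤ.* x ≡ - (m ℤ.+ (N ℤ.- (k ℤ.+ k))) ℤ.* x
    arith = solve-∀

    N-2k : + n ℤ.* + n ℤ.- (+ k ℤ.+ + k) ≡ + d
    N-2k = trans (cong (ℤ._- (+ k ℤ.+ + k)) (sym (ℤ.pos-* n n)))
          (trans (ℤ.m-n≡m⊖n (n ℕ.* n) (k ℕ.+ k)) (ℤ.⊖-≥ (ℕ.<⇒≤ 2k<N)))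

    EFg : ∀ v → Box n v → E (F g) v ≡ - (+ m+d) ℤ.* g v
    EFg v bv with rank v ℕ.≟ k
    ... | no r≢k rewrite commutator g v | FEg v bv | supp v bv r≢k = lem (- + m) (δ v) (- (+ m+d))
      where
      lem : ∀ p q r → p ℤ.* 0ℤ ℤ.+ q ℤ.* 0ℤ ≡ r ℤ.* 0ℤ
      lem = solve-∀
    ... | yes refl rewrite commutator g v | FEg v bv | δ-box v bv =
      trans (arith (+ m) (+ k) (+ n ℤ.* + n) (g v)) (cong (λ x → - (+ m ℤ.+ x) ℤ.* g v) N-2k)

    F-box : ∀ {f} v → Box n v → (∀ v′ → Box n v′ → rank v′ ≡ suc (rank v) → f v′ ≡ 0ℤ) → F f v ≡ 0ℤ
    F-box v bv h = F-zero v λ {v′} s → h v′ (box-⋗ s bv) (sym (⋖-rank s))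

    -- A copy of `k` to split on. At rank 0 the function `F g` reads `g` only in positive ranks,
    -- where it vanishes; otherwise the descent goes on with the larger scalar `m+d`.
    Fg≡0 : ∀ k′ → k′ ≡ k → ∀ v → Box n v → F g v ≡ 0ℤ
    Fg≡0 zero    refl v bv = F-box v bv (λ v′ bv′ r → supp v′ bv′ (λ r≡0 → ℕ.0≢1+n (trans (sym r≡0) r)))
    Fg≡0 (suc k′) refl = FE-negative⇒zero k′ m+d (F g)
      (λ v bv r → F-box v bv (λ v′ bv′ r′ → supp v′ bv′ (λ r″ → r (ℕ.suc-injective (trans (sym r′) r″)))))
      (ℕ.<-trans (ℕ.s≤s (ℕ.+-monoʳ-≤ k′ (ℕ.n≤1+n k′))) 2k<N)
      (λ v bv → trans (F-cong v (λ {v′} s → EFg v′ (box-⋗ s bv))) (F-* (- (+ m+d)) g v))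

    EFg≡0 : E (F g) w ≡ 0ℤ
    EFg≡0 = E-zero w λ {v} s → Fg≡0 k refl v (box-⋖ s box)

    cancel : g w ≡ 0ℤ
    -- E (F g) is both 0 and -(m + d) g, and m + d is positive because d is.
    cancel with ℤ.i*j≡0⇒i≡0∨j≡0 (- (+ m+d)) (trans (sym (EFg w box)) EFg≡0)
    ... | inj₂ eq = eq
    ... | inj₁ eq = ⊥-elim (ℕ.<⇒≢ (ℕ.≤-trans (ℕ.m<n⇒0<n∸m 2k<N) (ℕ.m≤n+m d m))
                                  (sym (ℤ.+-injective (ℤ.neg-injective eq))))

  E-injective : ∀ k g → Supported n k g → k ℕ.+ k < n ℕ.* n →
    (∀ w → Box n w → E g w ≡ 0ℤ) → ∀ w → Box n w → g w ≡ 0ℤ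
  E-injective k g supp 2k<N Eg≡0 = FE-negative⇒zero k 0 g supp 2k<N λ w bw →
    trans (F-zero w λ {v} s → Eg≡0 v (box-⋗ s bw)) (sym (ℤ.*-zeroˡ (g w)))

τ : Word → Word
τ []      = []
τ (a ∷ w) = τ w ∷ʳ not a

ascent : Bool → Bool → ℤ → ℤ
ascent false true x = x
ascent _     _    x = 0ℤ

-- `E` peels letters off the front, which `τ` sends to the back; this is the same recursion run from
-- the back.
E-∷ʳ∷ʳ : ∀ f w a b →
  E f (w ∷ʳ a ∷ʳ b) ≡ E (λ v → f (v ∷ʳ b)) (w ∷ʳ a) ℤ.+ ascent a b (f (w ∷ʳ true ∷ʳ false))
E-∷ʳ∷ʳ f []      false false = refl
E-∷ʳ∷ʳ f []      false true  = ℤ.+-comm (f (true ∷ false ∷ [])) 0ℤ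
E-∷ʳ∷ʳ f []      true  false = refl
E-∷ʳ∷ʳ f []      true  true  = refl
E-∷ʳ∷ʳ f (c ∷ w) a b =
  trans (cong₂ ℤ._+_ (head c w a) (E-∷ʳ∷ʳ (f ∘ (c ∷_)) w a b))
        (sym (ℤ.+-assoc (E₁ (λ v → f (v ∷ʳ b)) (c ∷ w ∷ʳ a)) _ _))
  where
  head : ∀ c w a → E₁ f (c ∷ w ∷ʳ a ∷ʳ b) ≡ E₁ (λ v → f (v ∷ʳ b)) (c ∷ w ∷ʳ a)
  head true  w           a     = refl
  head false (false ∷ w) a     = refl
  head false (true ∷ w)  a     = refl
  head false []          false = refl
  head false []          true  = refl

-- Reversal turns 01 into 10 and complementation restores 01, so conjugation permutes the moves
-- without changing their direction.
E-τ : ∀ f w → E (f ∘ τ) w ≡ E f (τ w)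
E-τ f []           = refl
E-τ f (false ∷ []) = refl
E-τ f (true ∷ [])  = refl
E-τ f (a ∷ b ∷ w)  = begin
  E₁ (f ∘ τ) (a ∷ b ∷ w) ℤ.+ E (f ∘ τ ∘ (a ∷_)) (b ∷ w)
    ≡⟨ cong₂ ℤ._+_ (head a b) (E-τ (λ v → f (v ∷ʳ not a)) (b ∷ w)) ⟩
  ascent (not b) (not a) (f (τ w ∷ʳ true ∷ʳ false)) ℤ.+ E (λ v → f (v ∷ʳ not a)) (τ (b ∷ w))
    ≡⟨ ℤ.+-comm (ascent (not b) (not a) _) _ ⟩
  E (λ v → f (v ∷ʳ not a)) (τ (b ∷ w)) ℤ.+ ascent (not b) (not a) (f (τ w ∷ʳ true ∷ʳ false))
    ≡⟨ E-∷ʳ∷ʳ f (τ w) (not b) (not a) ⟨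
  E f (τ (a ∷ b ∷ w)) ∎
  where
  open ≡-Reasoning
  head : ∀ a b → E₁ (f ∘ τ) (a ∷ b ∷ w) ≡ ascent (not b) (not a) (f (τ w ∷ʳ true ∷ʳ false))
  head false false = refl
  head false true  = refl
  head true  false = refl
  head true  true  = refl

length-≡ : ∀ {A : Set} {xs ys : List A} → Unique xs → Unique ys →
  (∀ {x} → x ∈ xs → x ∈ ys) → (∀ {x} → x ∈ ys → x ∈ xs) → length xs ≡ length ys
length-≡ uxs uys to from = ↭-length (∼bag⇒↭ (unique∧set⇒bag uxs uys (mk⇔ to from)))

-- Fraction-free elimination: fewer equations than unknowns leave a kernel element

module _ {X Y : Set} (L : (X → ℤ) → Y → ℤ)
  (L-linear : ∀ a b f g y → L (λ x → a ℤ.* f x ℤ.- b ℤ.* g x) y ≡ a ℤ.* L f y ℤ.- b ℤ.* L g y) where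

  -- Gaussian elimination.  The family φ is triangular with respect to xs, and C
  -- collects the linear conditions that the sought function has to keep.
  kernel-element : ∀ (C : (X → ℤ) → Set) →
    (∀ a b {f g} → C f → C g → C (λ x → a ℤ.* f x ℤ.- b ℤ.* g x)) →
    ∀ (xs : List X) (ys : List Y) (φ : X → X → ℤ) → length ys < length xs →
    All (λ x → C (φ x)) xs → All (λ x → φ x x ≢ 0ℤ) xs → AllPairs (λ x x′ → φ x x′ ≡ 0ℤ) xs →
    ∃[ f ] C f × All (λ y → L f y ≡ 0ℤ) ys × Any (λ x → f x ≢ 0ℤ) xs
  kernel-element C closed (x₀ ∷ xs) ys φ ys<xs (c₀ ∷ cs) (d₀ ∷ ds) (t₀ ∷ ts)
    with All.all? (λ y → L (φ x₀) y ℤ.≟ 0ℤ) ys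
  ... | yes Lφ₀≡0 = φ x₀ , c₀ , Lφ₀≡0 , here d₀
  ... | no Lφ₀≢0
    with find (All.¬All⇒Any¬ (λ y → L (φ x₀) y ℤ.≟ 0ℤ) ys Lφ₀≢0)
  ... | y₀ , y₀∈ys , p≢0 with ∈-∃++ y₀∈ys
  ... | ys₁ , ys₂ , refl =
    let f , (cf , Lf₀) , Lf , f≢0 = kernel-element C′ closed′ xs (ys₁ ++ ys₂) φ′ shorter
          (All.map c′ cs) (All.zipWith d′ (t₀ , ds)) (pairs t₀ ts)
    in f , cf , All.++⁺ (All.++⁻ˡ ys₁ Lf) (Lf₀ ∷ All.++⁻ʳ ys₁ Lf) , there f≢0
    where
    pivot : ℤ
    pivot = L (φ x₀) y₀

    φ′ : X → X → ℤ
    -- Cross-multiplication replaces division by the pivot: the two values of `L` at `y₀` cancel.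
    -- The equation at `y₀` leaves the list and becomes part of `C′`.
    φ′ x x′ = pivot ℤ.* φ x x′ ℤ.- L (φ x) y₀ ℤ.* φ x₀ x′

    C′ : (X → ℤ) → Set
    C′ f = C f × L f y₀ ≡ 0ℤ

    closed′ : ∀ a b {f g} → C′ f → C′ g → C′ (λ x → a ℤ.* f x ℤ.- b ℤ.* g x)
    closed′ a b {f} {g} (cf , f₀) (cg , g₀) = closed a b cf cg , (begin
      L (λ x → a ℤ.* f x ℤ.- b ℤ.* g x) y₀ ≡⟨ L-linear a b f g y₀ ⟩
      a ℤ.* L f y₀ ℤ.- b ℤ.* L g y₀        ≡⟨ cong₂ (λ s t → a ℤ.* s ℤ.- b ℤ.* t) f₀ g₀ ⟩
      a ℤ.* 0ℤ ℤ.- b ℤ.* 0ℤ                ≡⟨ vanish a b ⟩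
      0ℤ                                   ∎)
      where
      open ≡-Reasoning
      vanish : ∀ a b → a ℤ.* 0ℤ ℤ.- b ℤ.* 0ℤ ≡ 0ℤ
      vanish = solve-∀

    c′ : ∀ {x} → C (φ x) → C′ (φ′ x)
    c′ {x} cx = closed pivot (L (φ x) y₀) cx c₀ , trans (L-linear pivot (L (φ x) y₀) (φ x) (φ x₀) y₀) (swap-cancel pivot _)
      where
      swap-cancel : ∀ a b → a ℤ.* b ℤ.- b ℤ.* a ≡ 0ℤ
      swap-cancel = solve-∀

    drop : ∀ a b → a ℤ.- b ℤ.* 0ℤ ≡ a
    drop = solve-∀

    -- At later points `φ x₀` is zero by triangularity, so the new family is only rescaled there by
    -- the nonzero pivot and remains triangular.
    reduce : ∀ x {x′} → φ x₀ x′ ≡ 0ℤ → φ′ x x′ ≡ pivot ℤ.* φ x x′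
    reduce x {x′} eq = trans (cong (λ t → pivot ℤ.* φ x x′ ℤ.- L (φ x) y₀ ℤ.* t) eq) (drop (pivot ℤ.* φ x x′) (L (φ x) y₀))

    d′ : ∀ {x} → φ x₀ x ≡ 0ℤ × φ x x ≢ 0ℤ → φ′ x x ≢ 0ℤ
    d′ {x} (t , d) eq with ℤ.i*j≡0⇒i≡0∨j≡0 pivot (trans (sym (reduce x t)) eq)
    ... | inj₁ p≡0 = p≢0 p≡0
    ... | inj₂ d≡0 = d d≡0

    pairs : ∀ {xs} → All (λ x → φ x₀ x ≡ 0ℤ) xs → AllPairs (λ x x′ → φ x x′ ≡ 0ℤ) xs →
      AllPairs (λ x x′ → φ′ x x′ ≡ 0ℤ) xs
    pairs []       []        = []
    pairs (_ ∷ t₀) (tx ∷ ts) = All.zipWith (λ (t , t′) →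
        trans (reduce _ t) (trans (cong (pivot ℤ.*_) t′) (ℤ.*-zeroʳ pivot))) (t₀ , tx) ∷ pairs t₀ ts

    shorter : length (ys₁ ++ ys₂) < length xs
    shorter = ℕ.s≤s⁻¹ (subst (ℕ._< suc (length xs)) (List.length-++-sucʳ ys₁ y₀ ys₂) ys<xs)

-- Conjugation

zeros-∷ʳ : ∀ w a → zeros (w ∷ʳ a) ≡ zeros (a ∷ w)
zeros-∷ʳ []          a     = refl
zeros-∷ʳ (true ∷ w)  true  = zeros-∷ʳ w true
zeros-∷ʳ (true ∷ w)  false = zeros-∷ʳ w false
zeros-∷ʳ (false ∷ w) true  = cong suc (zeros-∷ʳ w true)
zeros-∷ʳ (false ∷ w) false = cong suc (zeros-∷ʳ w false)

ones-∷ʳ : ∀ w a → ones (w ∷ʳ a) ≡ ones (a ∷ w)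
ones-∷ʳ []          a     = refl
ones-∷ʳ (false ∷ w) true  = ones-∷ʳ w true
ones-∷ʳ (false ∷ w) false = ones-∷ʳ w false
ones-∷ʳ (true ∷ w)  true  = cong suc (ones-∷ʳ w true)
ones-∷ʳ (true ∷ w)  false = cong suc (ones-∷ʳ w false)

rank-∷ʳ-false : ∀ w → rank (w ∷ʳ false) ≡ rank w
rank-∷ʳ-false []          = refl
rank-∷ʳ-false (true ∷ w)  = rank-∷ʳ-false w
rank-∷ʳ-false (false ∷ w) = cong₂ ℕ._+_ (ones-∷ʳ w false) (rank-∷ʳ-false w)

-- The appended one forms a pair with every zero of the word.
rank-∷ʳ-true : ∀ w → rank (w ∷ʳ true) ≡ zeros w ℕ.+ rank w
rank-∷ʳ-true []          = refl
rank-∷ʳ-true (true ∷ w)  = rank-∷ʳ-true w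
rank-∷ʳ-true (false ∷ w) rewrite ones-∷ʳ w true | rank-∷ʳ-true w =
  cong suc (shuffle (ones w) (zeros w) (rank w))
  where
  shuffle : ∀ a b c → a ℕ.+ (b ℕ.+ c) ≡ b ℕ.+ (a ℕ.+ c)
  shuffle = ℕ-solve-∀

zeros-τ : ∀ w → zeros (τ w) ≡ ones w
zeros-τ []          = refl
zeros-τ (true ∷ w)  = trans (zeros-∷ʳ (τ w) false) (cong suc (zeros-τ w))
zeros-τ (false ∷ w) = trans (zeros-∷ʳ (τ w) true) (zeros-τ w)

ones-τ : ∀ w → ones (τ w) ≡ zeros w
ones-τ []          = refl
ones-τ (true ∷ w)  = trans (ones-∷ʳ (τ w) false) (ones-τ w)
ones-τ (false ∷ w) = trans (ones-∷ʳ (τ w) true) (cong suc (ones-τ w))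

rank-τ : ∀ w → rank (τ w) ≡ rank w
rank-τ []          = refl
rank-τ (true ∷ w)  = trans (rank-∷ʳ-false (τ w)) (rank-τ w)
rank-τ (false ∷ w) = trans (rank-∷ʳ-true (τ w)) (cong₂ ℕ._+_ (zeros-τ w) (rank-τ w))

τ-∷ʳ : ∀ w a → τ (w ∷ʳ a) ≡ not a ∷ τ w
τ-∷ʳ []      a = refl
τ-∷ʳ (b ∷ w) a = cong (_∷ʳ not b) (τ-∷ʳ w a)

τ-involutive : ∀ w → τ (τ w) ≡ w
τ-involutive []      = refl
τ-involutive (a ∷ w) = trans (τ-∷ʳ (τ w) (not a)) (cong₂ _∷_ (Bool.not-involutive a) (τ-involutive w))

τ-injective : ∀ {v w} → τ v ≡ τ w → v ≡ w
τ-injective {v} {w} eq = trans (sym (τ-involutive v)) (trans (cong τ eq) (τ-involutive w))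

τ-box : ∀ {n} w → Box n w → Box n (τ w)
τ-box w (z , o) = trans (zeros-τ w) o , trans (ones-τ w) z

infix 4 _≺_ _≟ʷ_ _≺?_
-- A total order singles out one word of each pair {w, τ w}. The lexicographic one is also reversed
-- by complementation on words of equal length, which the symmetry uses.
_≺_ : Word → Word → Set
_≺_ = Lex.Lex-< _≡_ Bool._<_

≺-cmp : Trichotomous _≡_ _≺_
≺-cmp v w with Lex.<-compare sym Bool.<-cmp v w
... | tri< a b c = tri< a (b ∘ ≡⇒Pointwise-≡) c
... | tri≈ a b c = tri≈ a (Pointwise-≡⇒≡ b) c
... | tri> a b c = tri> a (b ∘ ≡⇒Pointwise-≡) c

≺-asym : ∀ {v w} → v ≺ w → ¬ w ≺ v
≺-asym = Lex.<-asymmetric sym Bool.<-resp₂-≡ Bool.<-asym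

_≺?_ : ∀ v w → Dec (v ≺ w)
_≺?_ = Lex.<-decidable Bool._≟_ Bool._<?_

_≟ʷ_ : (v w : Word) → Dec (v ≡ w)
_≟ʷ_ = List.≡-dec Bool._≟_

-- Pascal's recursion on the first letter, in the same order of cases as `boxPartitions`, so that
-- sizes can be compared list against list.
words : ℕ → ℕ → List Word
words zero    c       = replicate c true ∷ []
words (suc r) zero    = replicate (suc r) false ∷ []
words (suc r) (suc c) = map (true ∷_) (words (suc r) c) ++ map (false ∷_) (words r (suc c))

zeros-replicate-true : ∀ c → zeros (replicate c true) ≡ 0
zeros-replicate-true zero    = refl
zeros-replicate-true (suc c) = zeros-replicate-true c

ones-replicate-true : ∀ c → ones (replicate c true) ≡ c
ones-replicate-true zero    = refl
ones-replicate-true (suc c) = cong suc (ones-replicate-true c)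

zeros-replicate-false : ∀ c → zeros (replicate c false) ≡ c
zeros-replicate-false zero    = refl
zeros-replicate-false (suc c) = cong suc (zeros-replicate-false c)

ones-replicate-false : ∀ c → ones (replicate c false) ≡ 0
ones-replicate-false zero    = refl
ones-replicate-false (suc c) = ones-replicate-false c

words-sound : ∀ r c → All (λ w → zeros w ≡ r × ones w ≡ c) (words r c)
words-sound zero    c       = (zeros-replicate-true c , ones-replicate-true c) ∷ []
words-sound (suc r) zero    = (cong suc (zeros-replicate-false r) , ones-replicate-false r) ∷ []
words-sound (suc r) (suc c) = All.++⁺
  (All.map⁺ (All.map (λ (z , o) → z , cong suc o) (words-sound (suc r) c)))
  (All.map⁺ (All.map (λ (z , o) → cong suc z , o) (words-sound r (suc c))))

all-true : ∀ w → zeros w ≡ 0 → w ≡ replicate (ones w) true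
all-true []         _  = refl
all-true (true ∷ w) eq = cong (true ∷_) (all-true w eq)

all-false : ∀ w → ones w ≡ 0 → w ≡ replicate (zeros w) false
all-false []          _  = refl
all-false (false ∷ w) eq = cong (false ∷_) (all-false w eq)

∈-words : ∀ w → w ∈ words (zeros w) (ones w)
∈-words w = complete (zeros w) (ones w) w refl refl
  where
  complete : ∀ r c w → zeros w ≡ r → ones w ≡ c → w ∈ words r c
  complete zero    c       w  z refl = here (all-true w z)
  complete (suc r) zero    w  z o    = here (trans (all-false w o) (cong (λ m → replicate m false) z))
  complete (suc r) (suc c) (true ∷ w)  z o = ∈-++⁺ˡ (∈-map⁺ (true ∷_) (complete (suc r) c w z (ℕ.suc-injective o)))
  complete (suc r) (suc c) (false ∷ w) z o =
    ∈-++⁺ʳ (map (true ∷_) (words (suc r) c)) (∈-map⁺ (false ∷_) (complete r (suc c) w (ℕ.suc-injective z) o))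

words-unique : ∀ r c → Unique (words r c)
words-unique zero    c       = [] ∷ []
words-unique (suc r) zero    = [] ∷ []
words-unique (suc r) (suc c) = Unique.++⁺
  (Unique.map⁺ List.∷-injectiveʳ (words-unique (suc r) c))
  (Unique.map⁺ List.∷-injectiveʳ (words-unique r (suc c)))
  λ (i , j) → disjoint (∈-map⁻ (true ∷_) i) (∈-map⁻ (false ∷_) j)
  where
  disjoint : ∀ {v} → ∃[ w ] w ∈ words (suc r) c × v ≡ true ∷ w →
    ¬ (∃[ w ] w ∈ words r (suc c) × v ≡ false ∷ w)
  disjoint (_ , _ , refl) (_ , _ , ())

level : ℕ → ℕ → List Word
level n k = filter (λ w → rank w ℕ.≟ k) (words n n)

∈-level⁺ : ∀ n k w → Box n w → rank w ≡ k → w ∈ level n k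
∈-level⁺ n k w (refl , o) r = ∈-filter⁺ (λ w → rank w ℕ.≟ k) (subst (λ c → w ∈ words (zeros w) c) o (∈-words w)) r

∈-level⁻ : ∀ n k w → w ∈ level n k → Box n w × rank w ≡ k
∈-level⁻ n k w i = let j , r = ∈-filter⁻ (λ w → rank w ℕ.≟ k) {xs = words n n} i in All.lookup (words-sound n n) j , r

level-unique : ∀ n k → Unique (level n k)
level-unique n k = Unique.filter⁺ _ (words-unique n n)

level-τ : ∀ n k w → w ∈ level n k → τ w ∈ level n k
level-τ n k w i = let bx , r = ∈-level⁻ n k w i in ∈-level⁺ n k (τ w) (τ-box w bx) (trans (rank-τ w) r)

-- `below` chooses one word from each two-element orbit of `τ` and so indexes a basis of the
-- antisymmetric functions on rank k; `fixed` holds the self-conjugate words.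
below fixed above : ℕ → ℕ → List Word
below n k = filter (λ w → w ≺? τ w) (level n k)
fixed n k = filter (λ w → w ≟ʷ τ w) (level n k)
above n k = filter (λ w → τ w ≺? w) (level n k)

length-filter-tri : ∀ ws → length ws ≡
  length (filter (λ w → w ≺? τ w) ws) ℕ.+ length (filter (λ w → w ≟ʷ τ w) ws) ℕ.+ length (filter (λ w → τ w ≺? w) ws)
length-filter-tri [] = refl
length-filter-tri (w ∷ ws) with ih ← length-filter-tri ws | ≺-cmp w (τ w)
... | tri< a b c
  rewrite List.filter-accept (λ w → w ≺? τ w) {xs = ws} a
        | List.filter-reject (λ w → w ≟ʷ τ w) {xs = ws} b
        | List.filter-reject (λ w → τ w ≺? w) {xs = ws} c = cong suc ih
... | tri≈ a b c
  rewrite List.filter-reject (λ w → w ≺? τ w) {xs = ws} a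
        | List.filter-accept (λ w → w ≟ʷ τ w) {xs = ws} b
        | List.filter-reject (λ w → τ w ≺? w) {xs = ws} c =
  trans (cong suc ih) (cong (ℕ._+ length (filter (λ w → τ w ≺? w) ws)) (sym (ℕ.+-suc (length (filter (λ w → w ≺? τ w) ws)) _)))
... | tri> a b c
  rewrite List.filter-reject (λ w → w ≺? τ w) {xs = ws} a
        | List.filter-reject (λ w → w ≟ʷ τ w) {xs = ws} b
        | List.filter-accept (λ w → τ w ≺? w) {xs = ws} c = trans (cong suc ih) (sym (ℕ.+-suc _ _))

above≡below : ∀ n k → length (above n k) ≡ length (below n k)
above≡below n k = trans
  (length-≡ (Unique.filter⁺ _ (level-unique n k)) (Unique.map⁺ τ-injective (Unique.filter⁺ _ (level-unique n k))) to from)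
  (List.length-map τ (below n k))
  where
  to : ∀ {w} → w ∈ above n k → w ∈ map τ (below n k)
  to {w} i = let j , τw≺w = ∈-filter⁻ (λ w → τ w ≺? w) {xs = level n k} i in
    subst (_∈ map τ (below n k)) (τ-involutive w)
      (∈-map⁺ τ (∈-filter⁺ (λ w → w ≺? τ w) (level-τ n k w j) (subst (τ w ≺_) (sym (τ-involutive w)) τw≺w)))
  from : ∀ {w} → w ∈ map τ (below n k) → w ∈ above n k
  from i with ∈-map⁻ τ i
  ... | v , j , refl = let j′ , v≺τv = ∈-filter⁻ (λ w → w ≺? τ w) {xs = level n k} j in
    ∈-filter⁺ (λ w → τ w ≺? w) (level-τ n k v j′) (subst (_≺ τ v) (sym (τ-involutive v)) v≺τv)

level-count : ∀ n k → length (level n k) ≡ length (below n k) ℕ.+ length (fixed n k) ℕ.+ length (below n k)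
level-count n k = trans (length-filter-tri (level n k)) (cong ((length (below n k) ℕ.+ length (fixed n k)) ℕ.+_) (above≡below n k))

indicator : Word → Word → ℤ
indicator v w with v ≟ʷ w
... | yes _ = 1ℤ
... | no  _ = 0ℤ

indicator-yes : ∀ {v w} → v ≡ w → indicator v w ≡ 1ℤ
indicator-yes {v} {w} eq with v ≟ʷ w
... | yes _ = refl
... | no ne = ⊥-elim (ne eq)

indicator-no : ∀ {v w} → v ≢ w → indicator v w ≡ 0ℤ
indicator-no {v} {w} ne with v ≟ʷ w
... | yes eq = ⊥-elim (ne eq)
... | no _   = refl

indicator-τ : ∀ v w → indicator v (τ w) ≡ indicator (τ v) w
indicator-τ v w with v ≟ʷ τ w | τ v ≟ʷ w
... | yes _  | yes _  = refl
... | no _   | no _   = refl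
... | yes eq | no ne  = ⊥-elim (ne (trans (cong τ eq) (τ-involutive w)))
... | no ne  | yes eq = ⊥-elim (ne (trans (sym (τ-involutive v)) (cong τ eq)))

Antisymmetric : Fun → Set
Antisymmetric f = ∀ w → f (τ w) ≡ - f w

E-linear : ∀ a b f g w → E (λ v → a ℤ.* f v ℤ.- b ℤ.* g v) w ≡ a ℤ.* E f w ℤ.- b ℤ.* E g w
E-linear a b f g w = begin
  E (λ v → a ℤ.* f v ℤ.- b ℤ.* g v) w             ≡⟨ E-cong w (λ {v} _ → cong (λ t → a ℤ.* f v ℤ.+ t) (ℤ.neg-distribˡ-* b (g v))) ⟩
  E (λ v → a ℤ.* f v ℤ.+ (- b) ℤ.* g v) w         ≡⟨ E-+ (λ v → a ℤ.* f v) (λ v → (- b) ℤ.* g v) w ⟩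
  E (λ v → a ℤ.* f v) w ℤ.+ E (λ v → (- b) ℤ.* g v) w ≡⟨ cong₂ ℤ._+_ (E-* a f w) (E-* (- b) g w) ⟩
  a ℤ.* E f w ℤ.+ (- b) ℤ.* E g w                 ≡⟨ cong (λ t → a ℤ.* E f w ℤ.+ t) (ℤ.neg-distribˡ-* b (E g w)) ⟨
  a ℤ.* E f w ℤ.- b ℤ.* E g w                     ∎
  where open ≡-Reasoning

E-antisymmetric : ∀ {f} → Antisymmetric f → Antisymmetric (E f)
E-antisymmetric {f} anti w = begin
  E f (τ w)               ≡⟨ E-τ f w ⟨
  E (f ∘ τ) w             ≡⟨ E-cong w (λ {v} _ → trans (anti v) (sym (ℤ.-1*i≡-i (f v)))) ⟩
  E (λ v → -1ℤ ℤ.* f v) w ≡⟨ E-* -1ℤ f w ⟩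
  -1ℤ ℤ.* E f w           ≡⟨ ℤ.-1*i≡-i (E f w) ⟩
  - E f w                 ∎
  where open ≡-Reasoning

i≡-i⇒i≡0 : ∀ {i} → i ≡ - i → i ≡ 0ℤ
i≡-i⇒i≡0 {+ zero} _ = refl

-- Were there fewer orbits in rank k + 1, elimination would give a nonzero antisymmetric f on rank k
-- with E f = 0 on the representatives there. Antisymmetry extends the vanishing to all of rank k +
-- 1, against injectivity of `E`.
below-mono : ∀ n k → k ℕ.+ k < n ℕ.* n → length (below n k) ≤ length (below n (suc k))
below-mono n k 2k<N = ℕ.≮⇒≥ λ lt → contra (kernel-element E E-linear C closed (below n k) (below n (suc k)) φ lt
    (All.tabulate C-φ) (All.tabulate φ-diagonal) (triangular (below n k) (λ i → i) (Unique.filter⁺ _ (level-unique n k))))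
  where
  C : Fun → Set
  C f = Supported n k f × Antisymmetric f

  closed : ∀ a b {f g} → C f → C g → C (λ w → a ℤ.* f w ℤ.- b ℤ.* g w)
  closed a b {f} {g} (sf , af) (sg , ag) =
      (λ w bw r → trans (cong₂ (λ s t → a ℤ.* s ℤ.- b ℤ.* t) (sf w bw r) (sg w bw r)) (vanish a b))
    , (λ w → trans (cong₂ (λ s t → a ℤ.* s ℤ.- b ℤ.* t) (af w) (ag w)) (negate a b (f w) (g w)))
    where
    vanish : ∀ a b → a ℤ.* 0ℤ ℤ.- b ℤ.* 0ℤ ≡ 0ℤ
    vanish = solve-∀
    negate : ∀ a b s t → a ℤ.* (- s) ℤ.- b ℤ.* (- t) ≡ - (a ℤ.* s ℤ.- b ℤ.* t)
    negate = solve-∀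

  -- The antisymmetrised point mass at `v`. Since `τ v` is never in `below`, the family is even
  -- diagonal on `below`.
  φ : Word → Word → ℤ
  φ v w = indicator v w ℤ.- indicator (τ v) w

  C-φ : ∀ {v} → v ∈ below n k → C (φ v)
  C-φ {v} i = support , anti
    where
    rank-v : rank v ≡ k
    rank-v = proj₂ (∈-level⁻ n k v (proj₁ (∈-filter⁻ (λ w → w ≺? τ w) {xs = level n k} i)))
    support : Supported n k (φ v)
    support w _ r≢k = cong₂ ℤ._-_ (indicator-no {v} {w} (λ eq → r≢k (trans (sym (cong rank eq)) rank-v)))
      (indicator-no {τ v} {w} (λ eq → r≢k (trans (sym (cong rank eq)) (trans (rank-τ v) rank-v))))
    flip : ∀ s t → s ℤ.- t ≡ - (t ℤ.- s)
    flip = solve-∀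
    anti : Antisymmetric (φ v)
    anti w = trans (cong₂ ℤ._-_ (indicator-τ v w) (trans (indicator-τ (τ v) w) (cong (λ t → indicator t w) (τ-involutive v))))
                   (flip (indicator (τ v) w) (indicator v w))

  ≺τ : ∀ {v} → v ∈ below n k → v ≺ τ v
  ≺τ i = proj₂ (∈-filter⁻ (λ w → w ≺? τ w) {xs = level n k} i)

  τ≢ : ∀ {v w} → v ∈ below n k → w ∈ below n k → τ v ≢ w
  τ≢ {v} i j refl = ≺-asym (≺τ i) (subst (τ v ≺_) (τ-involutive v) (≺τ j))

  φ-diagonal : ∀ {v} → v ∈ below n k → φ v v ≢ 0ℤ
  φ-diagonal {v} i eq with trans (sym (cong₂ ℤ._-_ (indicator-yes {v} refl) (indicator-no (τ≢ i i)))) eq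
  ... | ()

  triangular : ∀ vs → (∀ {v} → v ∈ vs → v ∈ below n k) → Unique vs → AllPairs (λ v w → φ v w ≡ 0ℤ) vs
  triangular []       sub []       = []
  triangular (v ∷ vs) sub (u ∷ us) =
    All.tabulate (λ {w} i → cong₂ ℤ._-_ (indicator-no (All.lookup u i)) (indicator-no (τ≢ (sub (here refl)) (sub (there i)))))
    ∷ triangular vs (sub ∘ there) us

  contra : ¬ (∃[ f ] C f × All (λ w → E f w ≡ 0ℤ) (below n (suc k)) × Any (λ v → f v ≢ 0ℤ) (below n k))
  contra (f , (supp , anti) , Ef≡0 , f≢0) =
    let v , i , fv≢0 = find f≢0
        box , _ = ∈-level⁻ n k v (proj₁ (∈-filter⁻ (λ w → w ≺? τ w) {xs = level n k} i))
    in fv≢0 (E-injective n k f supp 2k<N vanish v box)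
    where
    on-level : ∀ w → Box n w → rank w ≡ suc k → E f w ≡ 0ℤ
    on-level w bw r with ≺-cmp w (τ w)
    ... | tri< w≺τw _ _ = All.lookup Ef≡0 (∈-filter⁺ (λ w → w ≺? τ w) (∈-level⁺ n (suc k) w bw r) w≺τw)
    -- At a self-conjugate word an antisymmetric function equals its own negative, so such words
    -- impose no equation.
    ... | tri≈ _ w≡τw _ = i≡-i⇒i≡0 (trans (cong (E f) w≡τw) (E-antisymmetric anti w))
    ... | tri> _ _ τw≺w = ℤ.neg-injective (trans (sym (E-antisymmetric anti w))
      (All.lookup Ef≡0 (∈-filter⁺ (λ w → w ≺? τ w) (level-τ n (suc k) w (∈-level⁺ n (suc k) w bw r))
        (subst (τ w ≺_) (sym (τ-involutive w)) τw≺w))))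

    vanish : ∀ w → Box n w → E f w ≡ 0ℤ
    vanish w bw with rank w ℕ.≟ suc k
    ... | yes r = on-level w bw r
    ... | no r  = E-zero w λ {v} s → supp v (box-⋖ s bw) (λ rv → r (trans (sym (⋖-rank s)) (cong suc rv)))

-- The ring of polynomials

-- _≈_ unfolds to a function type, from which its arguments cannot be inferred.
infix 4 _≋_
record _≋_ (f g : Poly) : Set where
  constructor coeffwise
  field coeff-≡ : f ≈ g

open _≋_

≋-setoid : Setoid 0ℓ 0ℓ
≋-setoid = record
  { Carrier       = Poly
  ; _≈_           = _≋_
  ; isEquivalence = record
    { refl  = coeffwise λ k → refl
    ; sym   = λ p → coeffwise λ k → sym (coeff-≡ p k)
    ; trans = λ p q → coeffwise λ k → trans (coeff-≡ p k) (coeff-≡ q k)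
    }
  }

open Setoid ≋-setoid using () renaming (refl to ≋-refl; sym to ≋-sym; trans to ≋-trans)

⊕-cong : ∀ {f f′ g g′} → f ≋ f′ → g ≋ g′ → f ⊕ g ≋ f′ ⊕ g′
⊕-cong {f} {f′} {g} {g′} p q = coeffwise λ k →
  trans (coeff-⊕ f g k) (trans (cong₂ ℤ._+_ (coeff-≡ p k) (coeff-≡ q k)) (sym (coeff-⊕ f′ g′ k)))

⊕-comm : ∀ f g → f ⊕ g ≋ g ⊕ f
⊕-comm f g = coeffwise λ k → trans (coeff-⊕ f g k) (trans (ℤ.+-comm (coeff f k) _) (sym (coeff-⊕ g f k)))

⊕-assoc : ∀ f g h → (f ⊕ g) ⊕ h ≋ f ⊕ (g ⊕ h)
⊕-assoc f g h = coeffwise assoc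
  where
  assoc : (f ⊕ g) ⊕ h ≈ f ⊕ (g ⊕ h)
  assoc k rewrite coeff-⊕ (f ⊕ g) h k | coeff-⊕ f g k | coeff-⊕ f (g ⊕ h) k | coeff-⊕ g h k =
    ℤ.+-assoc (coeff f k) _ _

⊕-identityʳ : ∀ f → f ⊕ [] ≋ f
⊕-identityʳ f = coeffwise λ k → trans (coeff-⊕ f [] k) (ℤ.+-identityʳ _)

scale-cong : ∀ x {f g} → f ≋ g → scale x f ≋ scale x g
scale-cong x {f} {g} p = coeffwise λ k →
  trans (coeff-scale x f k) (trans (cong (x ℤ.*_) (coeff-≡ p k)) (sym (coeff-scale x g k)))

∷-cong : ∀ {x f g} → f ≋ g → x ∷ f ≋ x ∷ g
∷-cong p = coeffwise λ { zero → refl ; (suc k) → coeff-≡ p k }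

⊛-congˡ : ∀ f {g g′} → g ≋ g′ → f ⊛ g ≋ f ⊛ g′
⊛-congˡ []      p = ≋-refl
⊛-congˡ (x ∷ f) p = ⊕-cong (scale-cong x p) (∷-cong (⊛-congˡ f p))

0∷-⊛ : ∀ f g → (0ℤ ∷ f) ⊛ g ≋ 0ℤ ∷ (f ⊛ g)
0∷-⊛ f g = ⊕-cong {scale 0ℤ g} {[]} (coeffwise λ k → trans (coeff-scale 0ℤ g k) (ℤ.*-zeroˡ (coeff g k))) ≋-refl

⊛-distribʳ : ∀ h f g → (f ⊕ g) ⊛ h ≈ f ⊛ h ⊕ g ⊛ h
⊛-distribʳ h []      g       k = refl
⊛-distribʳ h (x ∷ f) []      k = sym (coeff-≡ (⊕-identityʳ ((x ∷ f) ⊛ h)) k)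
⊛-distribʳ h (x ∷ f) (y ∷ g) zero
  rewrite coeff-⊕ ((x ∷ f) ⊛ h) ((y ∷ g) ⊛ h) 0
        | coeff-⊛-zero (x ∷ f) h | coeff-⊛-zero (y ∷ g) h | coeff-⊛-zero ((x ℤ.+ y) ∷ (f ⊕ g)) h
  = ℤ.*-distribʳ-+ (coeff h 0) x y
⊛-distribʳ h (x ∷ f) (y ∷ g) (suc k)
  rewrite coeff-⊕ ((x ∷ f) ⊛ h) ((y ∷ g) ⊛ h) (suc k)
        | coeff-⊛-suc x f h k | coeff-⊛-suc y g h k | coeff-⊛-suc (x ℤ.+ y) (f ⊕ g) h k
        | ⊛-distribʳ h f g k | coeff-⊕ (f ⊛ h) (g ⊛ h) k
  = lemma x y (coeff h (suc k)) (coeff (f ⊛ h) k) (coeff (g ⊛ h) k)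
  where
  lemma : ∀ x y a b c → (x ℤ.+ y) ℤ.* a ℤ.+ (b ℤ.+ c) ≡ (x ℤ.* a ℤ.+ b) ℤ.+ (y ℤ.* a ℤ.+ c)
  lemma = solve-∀

scale-⊛ : ∀ x f g → scale x f ⊛ g ≈ scale x (f ⊛ g)
scale-⊛ x []      g k = refl
scale-⊛ x (y ∷ f) g zero
  rewrite coeff-⊛-zero (x ℤ.* y ∷ scale x f) g | coeff-scale x ((y ∷ f) ⊛ g) 0 | coeff-⊛-zero (y ∷ f) g
  = ℤ.*-assoc x y _
scale-⊛ x (y ∷ f) g (suc k)
  rewrite coeff-⊛-suc (x ℤ.* y) (scale x f) g k | coeff-scale x ((y ∷ f) ⊛ g) (suc k) | coeff-⊛-suc y f g k
        | scale-⊛ x f g k | coeff-scale x (f ⊛ g) k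
  = lemma x y (coeff g (suc k)) (coeff (f ⊛ g) k)
  where
  lemma : ∀ x y a b → x ℤ.* y ℤ.* a ℤ.+ x ℤ.* b ≡ x ℤ.* (y ℤ.* a ℤ.+ b)
  lemma = solve-∀

⊛-assoc : ∀ f g h → (f ⊛ g) ⊛ h ≋ f ⊛ (g ⊛ h)
⊛-assoc []      g h = ≋-refl
⊛-assoc (x ∷ f) g h = ≋-trans (coeffwise (⊛-distribʳ h (scale x g) (0ℤ ∷ f ⊛ g)))
  (⊕-cong {scale x g ⊛ h} (coeffwise (scale-⊛ x g h)) (≋-trans (0∷-⊛ (f ⊛ g) h) (∷-cong (⊛-assoc f g h))))

⊛-[] : ∀ f → f ⊛ [] ≈ []
⊛-[] []      k       = refl
⊛-[] (x ∷ f) zero    = refl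
⊛-[] (x ∷ f) (suc k) = ⊛-[] f k

-- `_⊛_` recurses on its left factor; commutativity rests on the mirrored recursion on the right
-- one.
⊛-∷ : ∀ f x g → f ⊛ (x ∷ g) ≈ scale x f ⊕ (0ℤ ∷ f ⊛ g)
⊛-∷ []      x g zero    = refl
⊛-∷ []      x g (suc k) = refl
⊛-∷ (y ∷ f) x g zero
  rewrite coeff-⊛-zero (y ∷ f) (x ∷ g) = lemma y x
  where
  lemma : ∀ y x → y ℤ.* x ≡ x ℤ.* y ℤ.+ 0ℤ
  lemma = solve-∀
⊛-∷ (y ∷ f) x g (suc k)
  rewrite coeff-⊛-suc y f (x ∷ g) k | ⊛-∷ f x g k
        | coeff-⊕ (scale x f) (0ℤ ∷ f ⊛ g) k
        | coeff-⊕ (scale x f) ((y ∷ f) ⊛ g) k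
        | coeff-⊕ (scale y g) (0ℤ ∷ f ⊛ g) k | coeff-scale y g k
  = lemma (y ℤ.* coeff g k) (coeff (scale x f) k) (coeff (0ℤ ∷ f ⊛ g) k)
  where
  lemma : ∀ a b c → a ℤ.+ (b ℤ.+ c) ≡ b ℤ.+ (a ℤ.+ c)
  lemma = solve-∀

⊛-comm : ∀ f g → f ⊛ g ≋ g ⊛ f
⊛-comm []      g = ≋-sym (coeffwise (⊛-[] g))
⊛-comm (x ∷ f) g = ≋-trans (⊕-cong ≋-refl (∷-cong (⊛-comm f g))) (≋-sym (coeffwise (⊛-∷ g x f)))

⊛-identityˡ : ∀ f → 𝟙 ⊛ f ≈ f
⊛-identityˡ f k rewrite coeff-⊕ (scale 1ℤ f) (0ℤ ∷ []) k | coeff-scale 1ℤ f k | ℤ.*-identityˡ (coeff f k) = zero-tail k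
  where
  zero-tail : ∀ k → coeff f k ℤ.+ coeff (0ℤ ∷ []) k ≡ coeff f k
  zero-tail zero    = ℤ.+-identityʳ _
  zero-tail (suc k) = ℤ.+-identityʳ _

⊖-inverseʳ : ∀ f → f ⊖ f ≈ []
⊖-inverseʳ f k rewrite coeff-⊕ f (scale -1ℤ f) k | coeff-scale -1ℤ f k | ℤ.-1*i≡-i (coeff f k) = ℤ.+-inverseʳ (coeff f k)

⊛-cong : ∀ {f f′ g g′} → f ≋ f′ → g ≋ g′ → f ⊛ g ≋ f′ ⊛ g′
⊛-cong {f} {f′} {g} {g′} p q =
  ≋-trans (⊛-congˡ f q) (≋-trans (⊛-comm f g′) (≋-trans (⊛-congˡ g′ p) (⊛-comm g′ f′)))

polyRing : CommutativeRing 0ℓ 0ℓ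
polyRing = record
  { Carrier = Poly ; _≈_ = _≋_ ; _+_ = _⊕_ ; _*_ = _⊛_ ; -_ = scale -1ℤ ; 0# = [] ; 1# = 𝟙
  ; isCommutativeRing = record
    { isRing = record
      { +-isAbelianGroup = record
        { isGroup = record
          { isMonoid = record
            { isSemigroup = record
              { isMagma = record { isEquivalence = Setoid.isEquivalence ≋-setoid ; ∙-cong = ⊕-cong }
              ; assoc = ⊕-assoc }
            ; identity = (λ f → ≋-refl) , ⊕-identityʳ }
          ; inverse = (λ f → ≋-trans (⊕-comm (scale -1ℤ f) f) (⊖-inverse f)) , ⊖-inverse
          ; ⁻¹-cong = scale-cong -1ℤ }
        ; comm = ⊕-comm }
      ; *-cong = ⊛-cong
      ; *-assoc = ⊛-assoc
      ; *-identity = ⊛-identity , λ f → ≋-trans (⊛-comm f 𝟙) (⊛-identity f)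
      ; distrib =
          (λ f g h → ≋-trans (⊛-comm f (g ⊕ h)) (≋-trans (distribʳ f g h) (⊕-cong (⊛-comm g f) (⊛-comm h f))))
        , distribʳ
      }
    ; *-comm = ⊛-comm
    }
  }
  where
  ⊖-inverse  = λ f → coeffwise (⊖-inverseʳ f)
  ⊛-identity = λ f → coeffwise (⊛-identityˡ f)
  distribʳ   = λ f g h → coeffwise (⊛-distribʳ f g h)

-- A vanishing constant such as `𝟙 ⊖ 𝟙` computes to a list of zeros rather than to `[]`, hence a
-- zero test that looks through zeros.
polyACR : ACR.AlmostCommutativeRing 0ℓ 0ℓ
polyACR = ACR.fromCommutativeRing polyRing isZero
  where
  isZero : ∀ f → Maybe ([] ≋ f)
  isZero []        = just ≋-refl
  isZero (+ 0 ∷ f) = Maybe.map (λ p → coeffwise λ { zero → refl ; (suc k) → coeff-≡ p k }) (isZero f)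
  isZero _         = nothing

≡⇒≋ : ∀ {f g} → f ≡ g → f ≋ g
≡⇒≋ refl = ≋-refl

∏-cong : ∀ n {f g} → (∀ i → f i ≡ g i) → ∏ n f ≡ ∏ n g
∏-cong zero    f≡g = refl
∏-cong (suc n) f≡g = cong₂ _⊛_ (∏-cong n f≡g) (f≡g (suc n))

∏-head : ∀ n f → ∏ (suc n) f ≋ f 1 ⊛ ∏ n (λ i → f (suc i))
∏-head zero    f = ⊛-comm 𝟙 (f 1)
∏-head (suc n) f = ≋-trans (⊛-cong (∏-head n f) ≋-refl) (⊛-assoc (f 1) _ _)

q^-+ : ∀ m k → q^ (m ℕ.+ k) ≋ q^ m ⊛ q^ k
q^-+ zero    k = ≋-sym (coeffwise (⊛-identityˡ (q^ k)))
q^-+ (suc m) k = ≋-trans (∷-cong (q^-+ m k)) (≋-sym (0∷-⊛ (q^ m) (q^ k)))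

-- Generating functions of lists of exponents

multiplicity : ℕ → List ℕ → ℕ
multiplicity k ms = length (filter (ℕ._≟ k) ms)

series : List ℕ → Poly
series = foldr (λ m f → q^ m ⊕ f) []

coeff-q^-≡ : ∀ k → coeff (q^ k) k ≡ 1ℤ
coeff-q^-≡ zero    = refl
coeff-q^-≡ (suc k) = coeff-q^-≡ k

coeff-q^-≢ : ∀ m k → m ≢ k → coeff (q^ m) k ≡ 0ℤ
coeff-q^-≢ zero    zero    m≢k = ⊥-elim (m≢k refl)
coeff-q^-≢ zero    (suc k) m≢k = refl
coeff-q^-≢ (suc m) zero    m≢k = refl
coeff-q^-≢ (suc m) (suc k) m≢k = coeff-q^-≢ m k (λ eq → m≢k (cong suc eq))

coeff-series : ∀ ms k → coeff (series ms) k ≡ + multiplicity k ms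
coeff-series []       k = refl
coeff-series (m ∷ ms) k with m ℕ.≟ k
... | yes refl rewrite List.filter-accept (ℕ._≟ k) {k} {ms} refl =
  trans (coeff-⊕ (q^ k) (series ms) k) (cong₂ ℤ._+_ (coeff-q^-≡ k) (coeff-series ms k))
... | no m≢k rewrite List.filter-reject (ℕ._≟ k) {m} {ms} m≢k =
  trans (coeff-⊕ (q^ m) (series ms) k) (cong₂ ℤ._+_ (coeff-q^-≢ m k m≢k) (coeff-series ms k))

series-++ : ∀ ms ms′ → series (ms ++ ms′) ≋ series ms ⊕ series ms′
series-++ []       ms′ = ≋-refl
series-++ (m ∷ ms) ms′ = ≋-trans (⊕-cong ≋-refl (series-++ ms ms′)) (≋-sym (⊕-assoc (q^ m) (series ms) (series ms′)))

series-shift : ∀ d ms → series (map (d ℕ.+_) ms) ≋ q^ d ⊛ series ms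
series-shift d []       = ≋-sym (coeffwise (⊛-[] (q^ d)))
series-shift d (m ∷ ms) = ≋-trans (⊕-cong (q^-+ d m) (series-shift d ms))
  (≋-sym (CommutativeRing.distribˡ polyRing (q^ d) (q^ m) (series ms)))

-- The q-Pascal rule with denominators cleared, for Q = q^(c+1) and R = q^(r+1). It comes down to (Q
-- - 1) + Q(R - 1) = QR - 1.
pascal-product : ∀ Q R P G₁ G₂ D → G₁ ⊛ (D ⊛ (R ⊖ 𝟙)) ≋ (Q ⊖ 𝟙) ⊛ P → G₂ ⊛ D ≋ P →
  (G₁ ⊕ Q ⊛ G₂) ⊛ (D ⊛ (R ⊖ 𝟙)) ≋ P ⊛ (Q ⊛ R ⊖ 𝟙)
pascal-product Q R P G₁ G₂ D eq₁ eq₂ =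
  ≋-trans (expand Q G₁ G₂ D (R ⊖ 𝟙)) (≋-trans (⊕-cong eq₁ (⊛-congˡ Q (⊛-cong eq₂ ≋-refl))) (collect Q R P))
  where
  expand : ∀ Q G₁ G₂ D d → (G₁ ⊕ Q ⊛ G₂) ⊛ (D ⊛ d) ≋ G₁ ⊛ (D ⊛ d) ⊕ Q ⊛ ((G₂ ⊛ D) ⊛ d)
  expand = Solver.solve-∀ polyACR
  collect : ∀ Q R P → (Q ⊖ 𝟙) ⊛ P ⊕ Q ⊛ (P ⊛ (R ⊖ 𝟙)) ≋ P ⊛ (Q ⊛ R ⊖ 𝟙)
  collect = Solver.solve-∀ polyACR

coeff-∑q-≤ : ∀ a N k → k ≤ N → coeff (∑q a N) k ≡ a k
coeff-∑q-≤ a N       zero    _         = refl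
coeff-∑q-≤ a (suc N) (suc k) (s≤s k≤N) = coeff-∑q-≤ (λ i → a (suc i)) N k k≤N

coeff-∑q-> : ∀ a N k → N < k → coeff (∑q a N) k ≡ 0ℤ
coeff-∑q-> a zero    (suc k) _         = refl
coeff-∑q-> a (suc N) (suc k) (s≤s N<k) = coeff-∑q-> (λ i → a (suc i)) N k N<k

-- Partitions as words

multiplicity-map : ∀ {A : Set} (f : A → ℕ) k xs → multiplicity k (map f xs) ≡ length (filter (λ x → f x ℕ.≟ k) xs)
multiplicity-map f k []       = refl
multiplicity-map f k (x ∷ xs) with f x ℕ.≡ᵇ k
... | true  = cong suc (multiplicity-map f k xs)
... | false = multiplicity-map f k xs

-- Trades filtering the partitions of each k for one explicit list of all admissible partitions of
-- every size, whose sums are then the exponents of a generating function.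
length-filter-partitions : ∀ {Q : List ℕ → Set} (Q? : Decidable Q) xss → Unique xss →
  (∀ {xs} → xs ∈ xss → All (0 <_) xs × Linked _≥_ xs × Q xs) →
  (∀ {xs} → All (0 <_) xs → Linked _≥_ xs → Q xs → xs ∈ xss) →
  ∀ k → length (filter Q? (partitions k)) ≡ multiplicity k (map sum xss)
length-filter-partitions Q? xss uniq sound complete k = trans
  (length-≡ (Unique.filter⁺ Q? (partitions-unique k)) (Unique.filter⁺ (λ xs → sum xs ℕ.≟ k) uniq) to from)
  (sym (multiplicity-map sum k xss))
  where
  to : ∀ {xs} → xs ∈ filter Q? (partitions k) → xs ∈ filter (λ xs → sum xs ℕ.≟ k) xss
  to i = let j , q = ∈-filter⁻ Q? {xs = partitions k} i
             pos , linked , eq = Equivalence.to (∈-partitions k) j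
         in ∈-filter⁺ (λ xs → sum xs ℕ.≟ k) (complete pos linked q) eq
  from : ∀ {xs} → xs ∈ filter (λ xs → sum xs ℕ.≟ k) xss → xs ∈ filter Q? (partitions k)
  from i = let j , eq = ∈-filter⁻ (λ xs → sum xs ℕ.≟ k) {xs = xss} i
               pos , linked , q = sound j
           in ∈-filter⁺ Q? (Equivalence.from (∈-partitions k) (pos , linked , eq)) q

linked-∷ : ∀ {x xs} → All (_≤ x) xs → Linked _≥_ xs → Linked _≥_ (x ∷ xs)
linked-∷ []      []     = [-]
linked-∷ (p ∷ _) [-]    = p ∷ [-]
linked-∷ (p ∷ _) (l ∷ ls) = p ∷ l ∷ ls

linked-head : ∀ {x xs} → Linked _≥_ (x ∷ xs) → All (_≤ x) xs
linked-head [-]      = []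
linked-head (p ∷ ls) = Linked.Linked⇒All (λ i≥j j≥k → ℕ.≤-trans j≥k i≥j) p ls

boxPartitions : ℕ → ℕ → List (List ℕ)
boxPartitions zero    c       = [] ∷ []
boxPartitions (suc r) zero    = [] ∷ []
boxPartitions (suc r) (suc c) = boxPartitions (suc r) c ++ map (suc c ∷_) (boxPartitions r (suc c))

boxPartitions-sound : ∀ r c → All (λ xs → All (0 <_) xs × Linked _≥_ xs × FitsIn r c xs) (boxPartitions r c)
boxPartitions-sound zero    c       = ([] , [] , z≤n , []) ∷ []
boxPartitions-sound (suc r) zero    = ([] , [] , z≤n , []) ∷ []
boxPartitions-sound (suc r) (suc c) = All.++⁺
  (All.map (λ (pos , linked , len , ≤c) → pos , linked , len , All.map ℕ.m≤n⇒m≤1+n ≤c) (boxPartitions-sound (suc r) c))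
  (All.map⁺ (All.map (λ (pos , linked , len , ≤c) → z<s ∷ pos , linked-∷ ≤c linked , s≤s len , ℕ.≤-refl ∷ ≤c)
                     (boxPartitions-sound r (suc c))))

boxPartitions-complete : ∀ r c {xs} → All (0 <_) xs → Linked _≥_ xs → FitsIn r c xs → xs ∈ boxPartitions r c
boxPartitions-complete zero    c       {[]}    _ _ _ = here refl
boxPartitions-complete (suc r) zero    {[]}    _ _ _ = here refl
boxPartitions-complete (suc r) zero    {x ∷ _} (0<x ∷ _) _ (_ , x≤0 ∷ _) = ⊥-elim (ℕ.<⇒≱ 0<x x≤0)
boxPartitions-complete (suc r) (suc c) {[]}    _ _ _ = ∈-++⁺ˡ (boxPartitions-complete (suc r) c [] [] (z≤n , []))
boxPartitions-complete (suc r) (suc c) {x ∷ xs} pos linked (s≤s len , x≤1+c ∷ ≤1+c) with x ℕ.≟ suc c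
... | yes refl = ∈-++⁺ʳ (boxPartitions (suc r) c)
      (∈-map⁺ (suc c ∷_) (boxPartitions-complete r (suc c) (All.tail pos) (Linked.tail linked) (len , ≤1+c)))
... | no x≢1+c = ∈-++⁺ˡ (boxPartitions-complete (suc r) c pos linked
      (s≤s len , x≤c ∷ All.map (λ y≤x → ℕ.≤-trans y≤x x≤c) (linked-head linked)))
  where
  x≤c : x ≤ c
  x≤c = ℕ.≤-pred (ℕ.≤∧≢⇒< x≤1+c x≢1+c)

boxPartitions-unique : ∀ r c → Unique (boxPartitions r c)
boxPartitions-unique zero    c       = [] ∷ []
boxPartitions-unique (suc r) zero    = [] ∷ []
boxPartitions-unique (suc r) (suc c) = Unique.++⁺ (boxPartitions-unique (suc r) c)
  (Unique.map⁺ List.∷-injectiveʳ (boxPartitions-unique r (suc c)))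
  λ (i , j) → disjoint i (∈-map⁻ (suc c ∷_) j)
  where
  disjoint : ∀ {v} → v ∈ boxPartitions (suc r) c → ¬ (∃[ xs ] xs ∈ boxPartitions r (suc c) × v ≡ suc c ∷ xs)
  disjoint i (_ , _ , refl) with All.lookup (boxPartitions-sound (suc r) c) i
  ... | _ , _ , _ , 1+c≤c ∷ _ = ℕ.1+n≰n 1+c≤c

rank-replicate-true : ∀ c → rank (replicate c true) ≡ 0
rank-replicate-true zero    = refl
rank-replicate-true (suc c) = rank-replicate-true c

rank-replicate-false : ∀ c → rank (replicate c false) ≡ 0
rank-replicate-false zero    = refl
rank-replicate-false (suc c) = cong₂ _+_ (ones-replicate-false c) (rank-replicate-false c)

ranks : ℕ → ℕ → List ℕ
ranks r c = map rank (words r c)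

ranks-suc : ∀ r c → ranks (suc r) (suc c) ≡ ranks (suc r) c ++ map (suc c ℕ.+_) (ranks r (suc c))
ranks-suc r c = trans (List.map-++ rank (map (true ∷_) (words (suc r) c)) _)
  (cong₂ _++_ (sym (List.map-∘ (words (suc r) c)))
    (trans (sym (List.map-∘ (words r (suc c))))
    (trans (List.map-cong-local (All.map (λ {w} (_ , o) → cong (_+ rank w) o) (words-sound r (suc c))))
           (List.map-∘ (words r (suc c))))))

-- A leading zero followed by c + 1 ones adds as much to the rank as a largest part c + 1 adds to
-- the sum. The recursions thus yield equal lists of sizes, and no explicit bijection has to be
-- built.
sums≡ranks : ∀ r c → map sum (boxPartitions r c) ≡ ranks r c
sums≡ranks zero    c       = cong (_∷ []) (sym (rank-replicate-true c))
sums≡ranks (suc r) zero    = cong (_∷ []) (sym (rank-replicate-false (suc r)))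
sums≡ranks (suc r) (suc c) = begin
  map sum (boxPartitions (suc r) (suc c))
    ≡⟨ List.map-++ sum (boxPartitions (suc r) c) _ ⟩
  map sum (boxPartitions (suc r) c) ++ map sum (map (suc c ∷_) (boxPartitions r (suc c)))
    ≡⟨ cong₂ _++_ (sums≡ranks (suc r) c) (trans (sym (List.map-∘ (boxPartitions r (suc c)))) (List.map-∘ (boxPartitions r (suc c)))) ⟩
  ranks (suc r) c ++ map (suc c ℕ.+_) (map sum (boxPartitions r (suc c)))
    ≡⟨ cong (λ ms → ranks (suc r) c ++ map (suc c ℕ.+_) ms) (sums≡ranks r (suc c)) ⟩
  ranks (suc r) c ++ map (suc c ℕ.+_) (ranks r (suc c))
    ≡⟨ ranks-suc r c ⟨
  ranks (suc r) (suc c) ∎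
  where open ≡-Reasoning

p≡multiplicity : ∀ k r c → p k r c ≡ multiplicity k (ranks r c)
p≡multiplicity k r c = trans
  (length-filter-partitions (fitsIn? r c) (boxPartitions r c) (boxPartitions-unique r c)
    (All.lookup (boxPartitions-sound r c)) (boxPartitions-complete r c) k)
  (cong (multiplicity k) (sums≡ranks r c))

p≡level : ∀ n k → p k n n ≡ length (level n k)
p≡level n k = trans (p≡multiplicity k n n) (multiplicity-map rank k (words n n))

-- Distinct odd parts and self-conjugate words

odd≡ : ∀ n → 2 * suc n ∸ 1 ≡ suc (2 * n)
odd≡ n = ℕ.+-suc n (n + 0)

oddPartitions : ℕ → List (List ℕ)
oddPartitions zero    = [] ∷ []
oddPartitions (suc n) = oddPartitions n ++ map ((2 * suc n ∸ 1) ∷_) (oddPartitions n)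

odd-< : ∀ n {x} → x ≤ 2 * n ∸ 1 → x < 2 * suc n ∸ 1
odd-< n x≤ rewrite odd≡ n = s≤s (ℕ.≤-trans x≤ (ℕ.m∸n≤m (2 * n) 1))

odd-odd : ∀ n → ¬ 2 ∣ 2 * suc n ∸ 1
odd-odd n 2∣ = ℕ.1+n≰n (∣⇒≤ (∣m+n∣m⇒∣n (subst (2 ∣_) (trans (odd≡ n) (ℕ.+-comm 1 (2 * n))) 2∣) (m∣m*n n)))

-- An odd number below 2n + 1 also misses 2n, so the bound falls by two.
odd-≤ : ∀ n {x} → ¬ 2 ∣ x → x < 2 * suc n ∸ 1 → x ≤ 2 * n ∸ 1
odd-≤ n {x} ¬2∣x x< = ℕ.<⇒≤pred (ℕ.≤∧≢⇒< (ℕ.≤-pred (subst (x <_) (odd≡ n) x<)) λ { refl → ¬2∣x (m∣m*n n) })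

oddPartitions-sound : ∀ n → All (λ xs → All (0 <_) xs × Linked _≥_ xs × DistinctOddUpTo (2 * n ∸ 1) xs) (oddPartitions n)
oddPartitions-sound zero    = ([] , [] , [] , [] , []) ∷ []
oddPartitions-sound (suc n) = All.++⁺
  (All.map (λ (pos , linked , uniq , odd , ≤m) → pos , linked , uniq , odd , All.map (ℕ.<⇒≤ ∘ odd-< n) ≤m) (oddPartitions-sound n))
  (All.map⁺ (All.map
    (λ (pos , linked , uniq , odd , ≤m) → let <m = All.map (odd-< n) ≤m in
        subst (0 <_) (sym (odd≡ n)) z<s ∷ pos
      , linked-∷ (All.map ℕ.<⇒≤ <m) linked
      , All.map ℕ.>⇒≢ <m ∷ uniq
      , odd-odd n ∷ odd
      , ℕ.≤-refl ∷ All.map ℕ.<⇒≤ <m)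
    (oddPartitions-sound n)))

oddPartitions-complete : ∀ n {xs} → All (0 <_) xs → Linked _≥_ xs → DistinctOddUpTo (2 * n ∸ 1) xs → xs ∈ oddPartitions n
oddPartitions-complete zero    {[]}    _ _ _ = here refl
oddPartitions-complete zero    {x ∷ _} (0<x ∷ _) _ (_ , _ , x≤0 ∷ _) = ⊥-elim (ℕ.<⇒≱ 0<x x≤0)
oddPartitions-complete (suc n) {[]}    _ _ _ = ∈-++⁺ˡ (oddPartitions-complete n [] [] ([] , [] , []))
oddPartitions-complete (suc n) {x ∷ xs} pos linked (x≢ ∷ uniq , ¬2∣x ∷ odd , x≤m ∷ ≤m) with x ℕ.≟ 2 * suc n ∸ 1
... | yes refl = ∈-++⁺ʳ (oddPartitions n) (∈-map⁺ ((2 * suc n ∸ 1) ∷_)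
      (oddPartitions-complete n (All.tail pos) (Linked.tail linked)
        (uniq , odd , All.zipWith (λ (¬2∣y , y≤m , m≢y) → odd-≤ n ¬2∣y (ℕ.≤∧≢⇒< y≤m (m≢y ∘ sym))) (odd , All.zip (≤m , x≢)))))
... | no x≢m = ∈-++⁺ˡ (oddPartitions-complete n pos linked
      (x≢ ∷ uniq , ¬2∣x ∷ odd , x≤ ∷ All.map (λ y≤x → ℕ.≤-trans y≤x x≤) (linked-head linked)))
  where
  x≤ : x ≤ 2 * n ∸ 1
  x≤ = odd-≤ n ¬2∣x (ℕ.≤∧≢⇒< x≤m x≢m)

oddPartitions-unique : ∀ n → Unique (oddPartitions n)
oddPartitions-unique zero    = [] ∷ []
oddPartitions-unique (suc n) = Unique.++⁺ (oddPartitions-unique n)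
  (Unique.map⁺ List.∷-injectiveʳ (oddPartitions-unique n))
  λ (i , j) → disjoint i (∈-map⁻ ((2 * suc n ∸ 1) ∷_) j)
  where
  disjoint : ∀ {v} → v ∈ oddPartitions n → ¬ (∃[ xs ] xs ∈ oddPartitions n × v ≡ (2 * suc n ∸ 1) ∷ xs)
  disjoint i (_ , _ , refl) with All.lookup (oddPartitions-sound n) i
  ... | _ , _ , _ , _ , m≤ ∷ _ = ℕ.<-irrefl refl (odd-< n m≤)

-- A self-conjugate word has opposite letters at its two ends and a self-conjugate word between
-- them. Ends 0 and 1 add the outermost hook of the larger square: this is the classical passage
-- from self-conjugate partitions to their principal hooks.
fixedWords : ℕ → List Word
fixedWords zero    = [] ∷ []
fixedWords (suc n) = map (λ w → true ∷ w ∷ʳ false) (fixedWords n) ++ map (λ w → false ∷ w ∷ʳ true) (fixedWords n)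

fixedWords-sound : ∀ n → All (λ w → Box n w × w ≡ τ w) (fixedWords n)
fixedWords-sound zero    = ((refl , refl) , refl) ∷ []
fixedWords-sound (suc n) = All.++⁺
  (All.map⁺ (All.map (λ {w} ((z , o) , eq) →
      (trans (zeros-∷ʳ w false) (cong suc z) , cong suc (trans (ones-∷ʳ w false) o))
    , trans (cong (λ v → true ∷ v ∷ʳ false) eq) (cong (_∷ʳ false) (sym (τ-∷ʳ w false)))) (fixedWords-sound n)))
  (All.map⁺ (All.map (λ {w} ((z , o) , eq) →
      (cong suc (trans (zeros-∷ʳ w true) z) , trans (ones-∷ʳ w true) (cong suc o))
    , trans (cong (λ v → false ∷ v ∷ʳ true) eq) (cong (_∷ʳ true) (sym (τ-∷ʳ w true)))) (fixedWords-sound n)))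

fixedWords-complete : ∀ n w → Box n w → w ≡ τ w → w ∈ fixedWords n
fixedWords-complete zero    []          _        _ = here refl
fixedWords-complete zero    (true ∷ w)  (_ , ()) _
fixedWords-complete zero    (false ∷ w) (() , _) _
fixedWords-complete (suc n) (a ∷ w) box eq with initLast w
fixedWords-complete (suc n) (true ∷ .[])  (() , _) eq | []
fixedWords-complete (suc n) (false ∷ .[]) (_ , ()) eq | []
fixedWords-complete (suc n) (a ∷ .(v ∷ʳ b)) box eq | v ∷ʳ′ b
  with List.∷-injective (trans eq (cong (_∷ʳ not a) (τ-∷ʳ v b)))
... | refl , eq′ with List.∷ʳ-injectiveˡ v (τ v) eq′
fixedWords-complete (suc n) (.true ∷ .(v ∷ʳ false)) (z , o) eq | v ∷ʳ′ false | refl , eq′ | v≡τv =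
  ∈-++⁺ˡ (∈-map⁺ (λ w → true ∷ w ∷ʳ false) (fixedWords-complete n v
    (ℕ.suc-injective (trans (sym (zeros-∷ʳ v false)) z) , trans (sym (ones-∷ʳ v false)) (ℕ.suc-injective o)) v≡τv))
fixedWords-complete (suc n) (.false ∷ .(v ∷ʳ true)) (z , o) eq | v ∷ʳ′ true | refl , eq′ | v≡τv =
  ∈-++⁺ʳ (map (λ w → true ∷ w ∷ʳ false) (fixedWords n)) (∈-map⁺ (λ w → false ∷ w ∷ʳ true) (fixedWords-complete n v
    (trans (sym (zeros-∷ʳ v true)) (ℕ.suc-injective z) , ℕ.suc-injective (trans (sym (ones-∷ʳ v true)) o)) v≡τv))

fixedWords-unique : ∀ n → Unique (fixedWords n)
fixedWords-unique zero    = [] ∷ []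
fixedWords-unique (suc n) = Unique.++⁺
  (Unique.map⁺ (λ {v} {w} eq → List.∷ʳ-injectiveˡ v w (List.∷-injectiveʳ eq)) (fixedWords-unique n))
  (Unique.map⁺ (λ {v} {w} eq → List.∷ʳ-injectiveˡ v w (List.∷-injectiveʳ eq)) (fixedWords-unique n))
  λ (i , j) → disjoint (∈-map⁻ (λ w → true ∷ w ∷ʳ false) i) (∈-map⁻ (λ w → false ∷ w ∷ʳ true) j)
  where
  disjoint : ∀ {v} → ∃[ w ] w ∈ fixedWords n × v ≡ true ∷ w ∷ʳ false →
    ¬ (∃[ w ] w ∈ fixedWords n × v ≡ false ∷ w ∷ʳ true)
  disjoint (_ , _ , refl) (_ , _ , ())

oddSums : ℕ → List ℕ
oddSums n = map sum (oddPartitions n)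

oddSums-suc : ∀ n → oddSums (suc n) ≡ oddSums n ++ map ((2 * suc n ∸ 1) ℕ.+_) (oddSums n)
oddSums-suc n = trans (List.map-++ sum (oddPartitions n) _)
  (cong (oddSums n ++_) (trans (sym (List.map-∘ (oddPartitions n))) (List.map-∘ (oddPartitions n))))

oddSums≡ranks : ∀ n → oddSums n ≡ map rank (fixedWords n)
oddSums≡ranks zero    = refl
oddSums≡ranks (suc n) = sym (begin
  map rank (fixedWords (suc n))
    ≡⟨ List.map-++ rank (map (λ w → true ∷ w ∷ʳ false) (fixedWords n)) _ ⟩
  map rank (map (λ w → true ∷ w ∷ʳ false) (fixedWords n)) ++ map rank (map (λ w → false ∷ w ∷ʳ true) (fixedWords n))
    ≡⟨ cong₂ _++_ (trans (sym (List.map-∘ (fixedWords n))) (List.map-cong rank-∷ʳ-false (fixedWords n)))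
                  (trans (sym (List.map-∘ (fixedWords n)))
                  (trans (List.map-cong-local (All.map (λ {w} → rank-outer w) (fixedWords-sound n))) (List.map-∘ (fixedWords n)))) ⟩
  map rank (fixedWords n) ++ map ((2 * suc n ∸ 1) ℕ.+_) (map rank (fixedWords n))
    ≡⟨ cong (λ ms → ms ++ map ((2 * suc n ∸ 1) ℕ.+_) ms) (oddSums≡ranks n) ⟨
  oddSums n ++ map ((2 * suc n ∸ 1) ℕ.+_) (oddSums n)
    ≡⟨ oddSums-suc n ⟨
  oddSums (suc n) ∎)
  where
  open ≡-Reasoning
  -- The new first zero precedes n + 1 ones, and the new last one follows n further zeros: 2n + 1
  -- pairs in all.
  rank-outer : ∀ w → Box n w × w ≡ τ w → rank (false ∷ w ∷ʳ true) ≡ (2 * suc n ∸ 1) + rank w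
  rank-outer w ((z , o) , _) rewrite ones-∷ʳ w true | rank-∷ʳ-true w | z | o | odd≡ n | ℕ.+-identityʳ n =
    cong suc (sym (ℕ.+-assoc n n (rank w)))

b≡multiplicity : ∀ k n → b k n ≡ multiplicity k (oddSums n)
b≡multiplicity k n = length-filter-partitions (distinctOddUpTo? (2 * n ∸ 1)) (oddPartitions n) (oddPartitions-unique n)
  (All.lookup (oddPartitions-sound n)) (oddPartitions-complete n) k

b≡fixed : ∀ n k → b k n ≡ length (fixed n k)
b≡fixed n k = begin
  b k n                                                    ≡⟨ b≡multiplicity k n ⟩
  multiplicity k (oddSums n)                               ≡⟨ cong (multiplicity k) (oddSums≡ranks n) ⟩
  multiplicity k (map rank (fixedWords n))                 ≡⟨ multiplicity-map rank k (fixedWords n) ⟩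
  length (filter (λ w → rank w ℕ.≟ k) (fixedWords n))
    ≡⟨ length-≡ (Unique.filter⁺ _ (fixedWords-unique n)) (Unique.filter⁺ _ (level-unique n k)) to from ⟩
  length (fixed n k)                                       ∎
  where
  open ≡-Reasoning
  to : ∀ {w} → w ∈ filter (λ w → rank w ℕ.≟ k) (fixedWords n) → w ∈ fixed n k
  to {w} i = let j , r = ∈-filter⁻ (λ w → rank w ℕ.≟ k) {xs = fixedWords n} i
                 box , eq = All.lookup (fixedWords-sound n) j
             in ∈-filter⁺ (λ w → w ≟ʷ τ w) (∈-level⁺ n k w box r) eq
  from : ∀ {w} → w ∈ fixed n k → w ∈ filter (λ w → rank w ℕ.≟ k) (fixedWords n)
  from {w} i = let j , eq = ∈-filter⁻ (λ w → w ≟ʷ τ w) {xs = level n k} i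
                   box , r = ∈-level⁻ n k w j
               in ∈-filter⁺ (λ w → rank w ℕ.≟ k) (fixedWords-complete n w box eq) r

c≡2below : ∀ n k → c n k ≡ + (length (below n k) + length (below n k))
c≡2below n k = begin
  + p k n n ℤ.- + b k n
    ≡⟨ cong₂ (λ x y → + x ℤ.- + y) (trans (p≡level n k) (level-count n k)) (b≡fixed n k) ⟩
  + (length (below n k) + length (fixed n k) + length (below n k)) ℤ.- + length (fixed n k)
    ≡⟨ cancel (+ length (below n k)) (+ length (fixed n k)) ⟩
  + (length (below n k) + length (below n k)) ∎
  where
  open ≡-Reasoning
  cancel : ∀ x y → (x ℤ.+ y ℤ.+ x) ℤ.- y ≡ x ℤ.+ x
  cancel = solve-∀

-- Complementation in the square

κ : Word → Word
κ = map not

κ-involutive : ∀ w → κ (κ w) ≡ w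
κ-involutive []      = refl
κ-involutive (a ∷ w) = cong₂ _∷_ (Bool.not-involutive a) (κ-involutive w)

κ-injective : ∀ {v w} → κ v ≡ κ w → v ≡ w
κ-injective {v} {w} eq = trans (sym (κ-involutive v)) (trans (cong κ eq) (κ-involutive w))

zeros-κ : ∀ w → zeros (κ w) ≡ ones w
zeros-κ []          = refl
zeros-κ (true ∷ w)  = cong suc (zeros-κ w)
zeros-κ (false ∷ w) = zeros-κ w

ones-κ : ∀ w → ones (κ w) ≡ zeros w
ones-κ []          = refl
ones-κ (true ∷ w)  = ones-κ w
ones-κ (false ∷ w) = cong suc (ones-κ w)

rank-κ : ∀ w → rank (κ w) + rank w ≡ zeros w * ones w
rank-κ [] = refl
rank-κ (true ∷ w) rewrite ones-κ w | ℕ.*-suc (zeros w) (ones w) =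
  trans (ℕ.+-assoc (zeros w) (rank (κ w)) (rank w)) (cong (zeros w ℕ.+_) (rank-κ w))
rank-κ (false ∷ w) = begin
  rank (κ w) + (ones w + rank w) ≡⟨ ℕ.+-comm (rank (κ w)) _ ⟩
  ones w + rank w + rank (κ w)   ≡⟨ ℕ.+-assoc (ones w) _ _ ⟩
  ones w + (rank w + rank (κ w)) ≡⟨ cong (_+_ (ones w)) (trans (ℕ.+-comm (rank w) _) (rank-κ w)) ⟩
  ones w + zeros w * ones w      ∎
  where open ≡-Reasoning

τ-κ : ∀ w → τ (κ w) ≡ κ (τ w)
τ-κ []      = refl
τ-κ (a ∷ w) = trans (cong (_∷ʳ not (not a)) (τ-κ w)) (sym (List.map-++ not (τ w) (not a ∷ [])))

-- The first difference changes direction. Equal lengths exclude a proper prefix, which would stay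
-- first after complementation.
κ-reverses-≺ : ∀ {v w} → length v ≡ length w → v ≺ w → κ w ≺ κ v
κ-reverses-≺ eq (base ())
κ-reverses-≺ () halt
κ-reverses-≺ eq (this Bool.f<t) = this Bool.f<t
κ-reverses-≺ eq (next refl v≺w) = next refl (κ-reverses-≺ (ℕ.suc-injective eq) v≺w)

length-τ : ∀ w → length (τ w) ≡ length w
length-τ []      = refl
length-τ (a ∷ w) = trans (List.length-++ (τ w)) (trans (ℕ.+-comm _ 1) (cong suc (length-τ w)))

-- Complementation commutes with `τ` but reverses the order, so it carries `below` to `above` in the
-- complementary rank; conjugation leads back to `below`.
below-sym : ∀ n k → k ≤ n * n → length (below n k) ≡ length (below n (n * n ∸ k))
below-sym n k k≤N = begin
  length (below n k)
    ≡⟨ length-≡ (Unique.filter⁺ _ (level-unique n k))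
                (Unique.map⁺ κ-injective (Unique.filter⁺ _ (level-unique n (n * n ∸ k)))) to from ⟩
  length (map κ (above n (n * n ∸ k))) ≡⟨ List.length-map κ (above n (n * n ∸ k)) ⟩
  length (above n (n * n ∸ k))         ≡⟨ above≡below n (n * n ∸ k) ⟩
  length (below n (n * n ∸ k))         ∎
  where
  open ≡-Reasoning
  level-κ : ∀ i j w → i + j ≡ n * n → w ∈ level n i → κ w ∈ level n j
  level-κ i j w i+j≡N w∈ with ∈-level⁻ n i w w∈
  ... | (z , o) , refl = ∈-level⁺ n j (κ w) (trans (zeros-κ w) o , trans (ones-κ w) z)
    (ℕ.+-cancelʳ-≡ (rank w) (rank (κ w)) j (trans (rank-κ w) (trans (cong₂ _*_ z o) (trans (sym i+j≡N) (ℕ.+-comm (rank w) j)))))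
  to : ∀ {w} → w ∈ below n k → w ∈ map κ (above n (n * n ∸ k))
  to {w} w∈ = let w∈′ , w≺τw = ∈-filter⁻ (λ w → w ≺? τ w) {xs = level n k} w∈ in
    subst (_∈ map κ (above n (n * n ∸ k))) (κ-involutive w) (∈-map⁺ κ (∈-filter⁺ (λ w → τ w ≺? w)
      (level-κ k (n * n ∸ k) w (ℕ.m+[n∸m]≡n k≤N) w∈′)
      (subst (_≺ κ w) (sym (τ-κ w)) (κ-reverses-≺ (sym (length-τ w)) w≺τw))))
  from : ∀ {w} → w ∈ map κ (above n (n * n ∸ k)) → w ∈ below n k
  from w∈ with ∈-map⁻ κ w∈
  ... | v , v∈ , refl = let v∈′ , τv≺v = ∈-filter⁻ (λ w → τ w ≺? w) {xs = level n (n * n ∸ k)} v∈ in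
    ∈-filter⁺ (λ w → w ≺? τ w) (level-κ (n * n ∸ k) k v (ℕ.m∸n+n≡m k≤N) v∈′)
      (subst (κ v ≺_) (sym (τ-κ v)) (κ-reverses-≺ (length-τ v) τv≺v))

-- Symmetry and unimodality of the coefficients

c-symmetric : ∀ n → Symmetric (n * n) (c n)
c-symmetric n k k≤N = trans (c≡2below n k)
  (trans (cong (λ m → + (m + m)) (below-sym n k k≤N)) (sym (c≡2below n (n * n ∸ k))))

c-mono : ∀ n k → k + k < n * n → c n k ℤ.≤ c n (suc k)
c-mono n k 2k<N rewrite c≡2below n k | c≡2below n (suc k) = ℤ.+≤+ (ℕ.+-mono-≤ (below-mono n k 2k<N) (below-mono n k 2k<N))

⌊n/2⌋+⌊n/2⌋≤n : ∀ n → ⌊ n /2⌋ + ⌊ n /2⌋ ≤ n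
⌊n/2⌋+⌊n/2⌋≤n n = subst (⌊ n /2⌋ + ⌊ n /2⌋ ≤_) (ℕ.⌊n/2⌋+⌈n/2⌉≡n n) (ℕ.+-monoʳ-≤ ⌊ n /2⌋ (ℕ.⌊n/2⌋≤⌈n/2⌉ n))

n≤1+⌊n/2⌋+⌊n/2⌋ : ∀ n → n ≤ suc (⌊ n /2⌋ + ⌊ n /2⌋)
n≤1+⌊n/2⌋+⌊n/2⌋ zero          = z≤n
n≤1+⌊n/2⌋+⌊n/2⌋ (suc zero)    = s≤s z≤n
n≤1+⌊n/2⌋+⌊n/2⌋ (suc (suc n)) = s≤s (subst (suc n ≤_) (cong suc (sym (ℕ.+-suc ⌊ n /2⌋ ⌊ n /2⌋))) (s≤s (n≤1+⌊n/2⌋+⌊n/2⌋ n)))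

c-unimodal : ∀ n → UnimodalAtMiddle (n * n) (c n)
c-unimodal n = rising , falling
  where
  N = n * n
  rising : ∀ k → k < ⌊ N /2⌋ → c n k ℤ.≤ c n (suc k)
  rising k k<h = c-mono n k (ℕ.<-≤-trans (ℕ.+-mono-< k<h k<h) (⌊n/2⌋+⌊n/2⌋≤n N))

  falling : ∀ k → ⌊ N /2⌋ ≤ k → k < N → c n k ℤ.≥ c n (suc k)
  falling k h≤k k<N = subst (λ x → c n (suc k) ℤ.≤ x) (sym (c-symmetric n k (ℕ.<⇒≤ k<N)))
    (subst (ℤ._≤ c n (N ∸ k)) (sym (c-symmetric n (suc k) k<N))
      (subst (λ m → c n j ℤ.≤ c n m) (sym N∸k≡1+j) (c-mono n j 2j<N)))
    where
    -- Reflection turns the step from k to k + 1 into the step from j to j + 1. Since j + k + 1 = N,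
    -- the inequality j ≤ k already puts j below the middle, for odd N as well.
    j = N ∸ suc k
    N∸k≡1+j : N ∸ k ≡ suc j
    N∸k≡1+j = ℕ.+-∸-assoc 1 k<N
    j≤k : j ≤ k
    j≤k = ℕ.≤-trans (ℕ.∸-monoˡ-≤ (suc k) (ℕ.≤-trans (n≤1+⌊n/2⌋+⌊n/2⌋ N) (s≤s (ℕ.+-mono-≤ h≤k h≤k))))
                    (ℕ.≤-reflexive (ℕ.m+n∸m≡n k k))
    2j<N : j + j < N
    2j<N = ℕ.≤-trans (s≤s (ℕ.+-monoˡ-≤ j j≤k)) (ℕ.≤-reflexive (ℕ.m+[n∸m]≡n k<N))

-- The Gaussian coefficient and the difference polynomial

gaussian-product : ∀ r c → series (ranks r c) ⊛ ∏ r (λ i → q^ i ⊖ 𝟙) ≋ ∏ r (λ i → q^ (c + i) ⊖ 𝟙)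
gaussian-product zero c rewrite rank-replicate-true c = coeffwise λ { zero → refl ; (suc k) → refl }
gaussian-product (suc r) zero rewrite rank-replicate-false (suc r) = coeffwise (⊛-identityˡ (∏ (suc r) (λ i → q^ i ⊖ 𝟙)))
gaussian-product (suc r) (suc c) =
  ≋-trans (⊛-cong (≋-trans (≡⇒≋ (cong series (ranks-suc r c)))
                  (≋-trans (series-++ (ranks (suc r) c) _) (⊕-cong ≋-refl (series-shift (suc c) (ranks r (suc c)))))) ≋-refl)
  (≋-trans (pascal-product (q^ suc c) (q^ suc r) P (series (ranks (suc r) c)) (series (ranks r (suc c))) D
             first (gaussian-product r (suc c)))
           (⊛-cong {P} ≋-refl (⊕-cong {g = scale -1ℤ 𝟙} (≋-sym (q^-+ (suc c) (suc r))) ≋-refl)))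
  where
  P = ∏ r (λ i → q^ (suc c + i) ⊖ 𝟙)
  D = ∏ r (λ i → q^ i ⊖ 𝟙)
  -- The first factor is split off the numerator of the (r + 1) × c box; what remains is the
  -- numerator `P` of the r × (c + 1) box, common to both terms.
  first : series (ranks (suc r) c) ⊛ (D ⊛ (q^ suc r ⊖ 𝟙)) ≋ (q^ suc c ⊖ 𝟙) ⊛ P
  first = ≋-trans (gaussian-product (suc r) c) (≋-trans (∏-head r (λ i → q^ (c + i) ⊖ 𝟙))
    (⊛-cong (≡⇒≋ (cong (λ m → q^ m ⊖ 𝟙) (ℕ.+-comm c 1))) (≡⇒≋ (∏-cong r (λ i → cong (λ m → q^ m ⊖ 𝟙) (ℕ.+-suc c i))))))

oddProduct≋series : ∀ n → oddProduct n ≋ series (oddSums n)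
oddProduct≋series zero    = coeffwise λ { zero → refl ; (suc k) → refl }
oddProduct≋series (suc n) = ≋-trans (⊛-cong (oddProduct≋series n) ≋-refl)
  (≋-trans (expand (series (oddSums n)) (q^ (2 * suc n ∸ 1)))
  (≋-sym (≋-trans (≡⇒≋ (cong series (oddSums-suc n)))
         (≋-trans (series-++ (oddSums n) _) (⊕-cong ≋-refl (series-shift (2 * suc n ∸ 1) (oddSums n)))))))
  where
  expand : ∀ f g → f ⊛ (𝟙 ⊕ g) ≋ f ⊕ g ⊛ f
  expand = Solver.solve-∀ polyACR

-- The ranks of a word and of its complement add up to n², so no word lies higher. Equality of
-- polynomials concerns every k, also beyond the end of `∑q`.
c-vanishes : ∀ n k → n * n < k → c n k ≡ 0ℤ
c-vanishes n k N<k = trans (c≡2below n k) (cong (λ ws → + (length ws + length ws)) below≡[])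
  where
  level≡[] : level n k ≡ []
  level≡[] = List.filter-none (λ w → rank w ℕ.≟ k) (All.map (λ {w} (z , o) r →
    ℕ.<⇒≱ N<k (subst (k ≤_) (trans (rank-κ w) (cong₂ _*_ z o))
      (subst (_≤ rank (κ w) + rank w) r (ℕ.m≤n+m (rank w) (rank (κ w)))))) (words-sound n n))
  below≡[] : below n k ≡ []
  below≡[] = cong (filter (λ w → w ≺? τ w)) level≡[]

difference : ∀ n → series (ranks n n) ⊖ oddProduct n ≈ ∑q (c n) (n * n)
difference n k = trans coeff-c truncate
  where
  coeff-c : coeff (series (ranks n n) ⊖ oddProduct n) k ≡ c n k
  coeff-c rewrite coeff-⊕ (series (ranks n n)) (scale -1ℤ (oddProduct n)) k
                | coeff-scale -1ℤ (oddProduct n) k | ℤ.-1*i≡-i (coeff (oddProduct n) k)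
                | coeff-≡ (oddProduct≋series n) k
                | coeff-series (ranks n n) k | coeff-series (oddSums n) k
                | p≡multiplicity k n n | b≡multiplicity k n = refl
  truncate : c n k ≡ coeff (∑q (c n) (n * n)) k
  truncate with k ℕ.≤? n * n
  ... | yes k≤N = sym (coeff-∑q-≤ (c n) (n * n) k k≤N)
  ... | no k≰N  = trans (c-vanishes n k (ℕ.≰⇒> k≰N)) (sym (coeff-∑q-> (c n) (n * n) k (ℕ.≰⇒> k≰N)))

theorem4p1 : (n : ℕ) .{{_ : NonZero n}} →
    (∃[ G ] IsCentralGaussian n G × G ⊖ oddProduct n ≈ ∑q (c n) (n * n))
    × Symmetric (n * n) (c n)
    × UnimodalAtMiddle (n * n) (c n)
theorem4p1 n = (series (ranks n n) , coeff-≡ (gaussian-product n n) , difference n) , c-symmetric n , c-unimodal n
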